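{- Let $r,t$ be integers with $r\geq 3$ and $t$ odd. Then $$\operatorname{gr}_4(P_5:S_t^r)= \begin{cases} \frac{3t-5}{2}, & \text{if } 3\leq r\leq \left\lfloor\frac{t-1}{4}\right\rfloor;\\ t+2r-2, & \text{if } \left\lceil\frac{t-1}{4}\right\rceil\leq r\leq \frac{t-3}{2}. \end{cases}$$
   Context: All graphs are finite, simple and undirected. $K_n$ is the complete graph on $n$ vertices and $P_5$ is the path with $5$ vertices and $4$ edges. $S_t^r$ is the graph of order $t$ obtained from the star $K_{1,t-1}$ by adding $r$ pairwise independent edges between the leaves, so that it has $r$ triangles (sharing the center) and $t-2r-1$ pendent edges. A $k$-edge-coloring assigns to each edge one of $k$ colors; all $k$-edge-colorings are assumed exact, i.e. each of the $k$ colors is used at least once. An edge-colored graph is rainbow if all its edges have different colors and monochromatic if all its edges have a single color. A copy of a graph means a (not necessarily induced) subgraph isomorphic to it. For non-empty graphs $G,H$ (graphs with at least one edge) and a positive integer $k$, the Gallai-Ramsey number $\operatorname{gr}_k(G:H)$ is the minimum integer $N$ with $\binom{N}{2}\geq k$ (so that $K_N$ admits a $k$-edge-coloring) such that for all $n\geq N$, every $k$-edge-coloring of $K_n$ contains either a rainbow copy of $G$ or a monochromatic copy of $H$. -}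

module Defs where

open import Level using (0ℓ)
open import Data.Nat using (ℕ; suc; _+_; _*_; _∸_; _/_; _≤_; _<_; NonZero)
open import Data.Nat.Combinatorics using (_C_)
import Data.Nat.Properties as ℕ
open import Data.Fin using (Fin; toℕ)
import Data.Fin.Properties as Fin
open import Data.Product using (_×_; _,_; ∃; ∃₂; ∃-syntax)
open import Data.Sum using (_⊎_; inj₁; inj₂; swap)
open import Relation.Binary using (Rel; Symmetric; Irreflexive; Decidable)
open import Relation.Binary.PropositionalEquality using (_≡_; _≢_; refl; sym; trans; ≢-sym)
open import Relation.Nullary using (¬_)
open import Relation.Nullary.Decidable using (_×-dec_; _⊎-dec_; ¬?)
open import Function.Definitions using (Injective)

record Graph : Set₁ where
  field
    order   : ℕ
    Adj     : Rel (Fin order) 0ℓ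
    adj?    : Decidable Adj
    symm    : Symmetric Adj
    irrefl  : Irreflexive _≡_ Adj

  Vertex : Set
  Vertex = Fin order

-- The simple graph on Fin n in which i and j are adjacent iff E i j or E j i.
fromEdges : (n : ℕ) (E : Rel (Fin n) 0ℓ) → Decidable E → (∀ i → ¬ E i i) → Graph
fromEdges n E E? loopless = record
  { order  = n
  ; Adj    = λ i j → E i j ⊎ E j i
  ; adj?   = λ i j → E? i j ⊎-dec E? j i
  ; symm   = swap
  ; irrefl = λ { refl (inj₁ e) → loopless _ e ; refl (inj₂ e) → loopless _ e }
  }

K : ℕ → Graph
K n = record
  { order  = n
  ; Adj    = _≢_
  ; adj?   = λ i j → ¬? (i Fin.≟ j)
  ; symm   = ≢-sym
  ; irrefl = λ i≡j i≢j → i≢j i≡j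
  }

-- The path with n vertices.
P : ℕ → Graph
P n = fromEdges n (λ i j → toℕ j ≡ suc (toℕ i))
  (λ i j → toℕ j ℕ.≟ suc (toℕ i))
  (λ i e → ℕ.1+n≢n (sym e))

-- The graph S_t^r: vertex 0 is the centre, 1, …, t-1 are the leaves, and the
-- r added independent edges are {1,2}, {3,4}, …, {2r-1,2r}.  All of them fit
-- among the leaves exactly when 2r + 1 ≤ t; for other parameters this is not
-- meant to denote anything.
module _ (t r : ℕ) where

  Spoke : Rel (Fin t) 0ℓ
  Spoke i j = toℕ i ≡ 0 × 0 < toℕ j

  Added : Rel (Fin t) 0ℓ
  Added i j = ∃[ m ] (toℕ i ≡ 1 + 2 * toℕ {r} m × toℕ j ≡ 2 + 2 * toℕ m)

  S : Graph
  S = fromEdges t (λ i j → Spoke i j ⊎ Added i j)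
    (λ i j →
      ((toℕ i ℕ.≟ 0) ×-dec (0 ℕ.<? toℕ j))
      ⊎-dec Fin.any? (λ m → (toℕ i ℕ.≟ 1 + 2 * toℕ m) ×-dec (toℕ j ℕ.≟ 2 + 2 * toℕ m)))
    (λ { i (inj₁ (z , p))     → ℕ.<⇒≢ p (sym z)
       ; i (inj₂ (_ , a , b)) → ℕ.1+n≢n (trans (sym b) a) })

-- A not necessarily induced copy of G in H.
record Copy (G H : Graph) : Set where
  private
    module G = Graph G
    module H = Graph H
  field
    embed     : G.Vertex → H.Vertex
    injective : Injective _≡_ _≡_ embed
    preserves : ∀ {u v} → G.Adj u v → H.Adj (embed u) (embed v)

-- Exact k-edge-colourings.  Only the values of colour on adjacent pairs
-- matter; exactness and the predicates below ignore all other pairs.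
record EdgeColouring (k : ℕ) (G : Graph) : Set where
  open Graph G
  field
    colour     : Vertex → Vertex → Fin k
    colour-sym : ∀ u v → colour u v ≡ colour v u
    exact      : ∀ c → ∃₂ λ u v → Adj u v × colour u v ≡ c

module _ {k : ℕ} {G H : Graph} (χ : EdgeColouring k H) (f : Copy G H) where
  open Graph G
  open EdgeColouring χ
  open Copy f

  edgeColour : Vertex → Vertex → Fin k
  edgeColour u v = colour (embed u) (embed v)

  Rainbow : Set
  Rainbow = ∀ {u v x y} → Adj u v → Adj x y → edgeColour u v ≡ edgeColour x y →
            (u ≡ x × v ≡ y) ⊎ (u ≡ y × v ≡ x)

  Monochromatic : Set
  Monochromatic = ∃[ c ] (∀ {u v} → Adj u v → edgeColour u v ≡ c)

GallaiRamseyBound : ℕ → Graph → Graph → ℕ → Set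
GallaiRamseyBound k G H N =
  k ≤ N C 2 ×
  (∀ n → N ≤ n → (χ : EdgeColouring k (K n)) →
    (∃[ f ] Rainbow {G = G} χ f) ⊎ (∃[ f ] Monochromatic {G = H} χ f))

-- gr k ⟨ G ∶ H ⟩≡ N says that gr_k(G : H) exists and equals N.  It is a
-- relation because the existence of the minimum is not known in advance.
gr_⟨_∶_⟩≡_ : ℕ → Graph → Graph → ℕ → Set
gr k ⟨ G ∶ H ⟩≡ N =
  GallaiRamseyBound k G H N × (∀ M → GallaiRamseyBound k G H M → N ≤ M)

⌈_/_⌉ : (m d : ℕ) .{{_ : NonZero d}} → ℕ
⌈ m / d ⌉ = (m + (d ∸ 1)) / d

{-# OPTIONS --safe #-}
module Submission where

-- Lower bound: split the vertices into three parts, give the edges inside each part a colour of its own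
-- and all other edges the fourth colour.  A path with only one crossing edge meets only two parts, so no
-- P₅ is rainbow.
--
-- Upper bound: suppose that no P₅ is rainbow.  There is a rainbow path a b c d.  If one of its vertices
-- meets the fourth colour, then all edges avoiding a, b, c, d have one colour, and n − 4 ≥ t.
-- Otherwise an edge of the fourth colour is disjoint from the path; then the colour of bc dominates, in the
-- sense that every vertex meets at most one other colour.  Hence the vertices split into parts A, B, C with
-- |A| ≥ |B| ≥ |C| > 0 such that edges between parts have the dominating colour, and edges inside a part
-- have that colour or the colour of the part.  Match vertices of A greedily by r − |B| edges of the
-- dominating colour.  If this succeeds, these edges and edges between A and B are the petals of a copy of
-- S_t^r centred in C.  If it gets stuck, the unmatched vertices of A are a clique in the colour of A,
-- large enough to contain S_t^r.

open import Defs
open import Data.Bool using (Bool; true; false; T; if_then_else_; _∧_; _∨_; not)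
open import Data.Bool.ListAction using (all; any)
open import Data.Bool.Properties using (T-∧; T-∨)
open import Data.Fin using (Fin; zero; suc; toℕ; inject₁; inject≤; fromℕ<; splitAt; _↑ˡ_; _↑ʳ_)
import Data.Fin as Fin using (_<_)
import Data.Fin.Properties as Fin
open import Data.Fin.Patterns
open import Data.List using (List; []; _∷_; _++_; map; length; lookup; allFin; concatMap; filter; cartesianProduct; replicate)
open import Data.List.Membership.Propositional using (_∈_; _∉_)
open import Data.List.Membership.Propositional.Properties using (∈-allFin; ∈-lookup; ∈-map⁺; ∈-filter⁺; ∈-filter⁻; ∈-++⁺ˡ; ∈-++⁺ʳ; ∈-++⁻)
import Data.List.Membership.DecPropositional as DecMembership
open import Data.List.Properties using (length-map; length-++; length-tabulate; length-replicate; ++-assoc)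
open import Data.List.Relation.Binary.Permutation.Propositional using (_↭_; ↭-refl; ↭-sym; ↭-trans; ↭-prep; ↭-swap; ↭⇒↭ₛ; module PermutationReasoning)
open import Data.List.Relation.Binary.Permutation.Propositional.Properties using (All-resp-↭; ∈-resp-↭; ↭-length; ++⁺ˡ; ++⁺ʳ; ++-comm; shift)
import Data.List.Relation.Binary.Permutation.Setoid.Properties as SetoidPermutation
open import Data.List.Relation.Unary.All as All using (All; []; _∷_)
import Data.List.Relation.Unary.All.Properties as All
open import Data.List.Relation.Unary.AllPairs as AllPairs using (AllPairs; []; _∷_)
open import Data.List.Relation.Unary.Any as Any using (Any; here; there)
open import Data.List.Relation.Unary.Any.Properties using (any⁻; lookup-index)
open import Data.List.Relation.Unary.Unique.Propositional using (Unique)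
import Data.List.Relation.Unary.Unique.Propositional.Properties as Unique
import Data.List.Relation.Unary.Unique.DecPropositional as DecUnique
open import Data.Maybe using (Maybe; just; nothing; is-just)
open import Data.Nat using (ℕ; zero; suc; _+_; _*_; _∸_; _/_; _%_; _≤_; _<_; z≤n; s≤s; s≤s⁻¹; ⌊_/2⌋)
open import Data.Nat.Combinatorics using (_C_; nC1≡n; nCk+nC[k+1]≡[n+1]C[k+1])
open import Data.Nat.DivMod using (m≡m%n+[m/n]*n; m%n<n; m/n*n≤m; m*n/n≡m)
import Data.Nat.Properties as ℕ
open import Data.Nat.Tactic.RingSolver using (solve-∀)
open import Data.Product using (Σ; ∃; ∃₂; ∃-syntax; _×_; _,_; proj₁; proj₂)
open import Data.Sum using (_⊎_; inj₁; inj₂; map₂; [_,_]′)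
open import Function using (_∘_; case_of_; Equivalence)
open import Function.Definitions using (Injective)
open import Relation.Binary using (Symmetric; tri<; tri≈; tri>)
open import Relation.Binary.PropositionalEquality using (_≡_; _≢_; refl; sym; trans; cong; cong₂; subst; subst₂; ≢-sym; setoid)
open import Relation.Nullary using (¬_; Dec; yes; no; does; contradiction)
open import Relation.Nullary.Decidable using (_×-dec_; _⊎-dec_; _→-dec_; ¬?; map′; toWitness; decidable-stable)

-- Searching the extensions of a partial colouring

Colour : Set
Colour = Fin 4

T⇒ : ∀ {P : Set} (P? : Dec P) → T (does P?) → P
T⇒ (yes p) _ = p

lookup-injective : ∀ {A : Set} {xs : List A} → Unique xs → Injective _≡_ _≡_ (lookup xs)
lookup-injective (_   ∷ _)  {zero}  {zero}  _  = refl
lookup-injective (x∉ ∷ _)  {zero}  {suc j} eq = contradiction eq (All.lookup x∉ (∈-lookup j))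
lookup-injective (x∉ ∷ _)  {suc i} {zero}  eq = contradiction (sym eq) (All.lookup x∉ (∈-lookup i))
lookup-injective (_   ∷ xs!) {suc i} {suc j} eq = cong suc (lookup-injective xs! eq)

-- If y were missed, sending `zero` to y would extend f to an injection from n + 1 elements into n.
injective⇒surjective : ∀ {n} {f : Fin n → Fin n} → Injective _≡_ _≡_ f → ∀ y → ∃[ x ] f x ≡ y
injective⇒surjective {n} {f} f-inj y = decidable-stable (Fin.any? λ x → f x Fin.≟ y) λ ¬hit →
  ℕ.1+n≰n (Fin.injective⇒≤ {f = g} (g-inj ¬hit))
  where
  g : Fin (suc n) → Fin n
  g zero    = y
  g (suc x) = f x
  g-inj : ¬ (∃[ x ] f x ≡ y) → Injective _≡_ _≡_ g
  g-inj _    {zero}  {zero}  _  = refl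
  g-inj ¬hit {zero}  {suc j} eq = contradiction (j , sym eq) ¬hit
  g-inj ¬hit {suc i} {zero}  eq = contradiction (i , eq) ¬hit
  g-inj _    {suc i} {suc j} eq = cong suc (f-inj eq)

module PartialColouring (m : ℕ) where

  Label : Set
  Label = Fin m

  Partial : Set
  Partial = List (Label × Label × Colour)

  open DecUnique (Fin._≟_ {m}) using () renaming (unique? to distinct?)
  open DecUnique (Fin._≟_ {4}) using () renaming (unique? to rainbow?)

  same? : (i j a b : Label) → Dec ((i ≡ a × j ≡ b) ⊎ (i ≡ b × j ≡ a))
  same? i j a b = (i Fin.≟ a ×-dec j Fin.≟ b) ⊎-dec (i Fin.≟ b ×-dec j Fin.≟ a)

  colourOf : Partial → Label → Label → Maybe Colour
  colourOf []              i j = nothing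
  colourOf ((a , b , c) ∷ σ) i j with same? i j a b
  ... | yes _ = just c
  ... | no  _ = colourOf σ i j

  known : Partial → Label → Label → Colour → Bool
  known σ i j c with colourOf σ i j
  ... | nothing = false
  ... | just c′ = does (c Fin.≟ c′)

  coloursAlong : Partial → List Label → Maybe (List Colour)
  coloursAlong σ []           = just []
  coloursAlong σ (i ∷ [])     = just []
  coloursAlong σ (i ∷ j ∷ is) with colourOf σ i j | coloursAlong σ (j ∷ is)
  ... | just c | just cs = just (c ∷ cs)
  ... | _      | _       = nothing

  isRainbowPath : ℕ → Partial → List Label → Bool
  isRainbowPath k σ is with coloursAlong σ is
  ... | nothing = false
  ... | just cs = does (length is ℕ.≟ suc k) ∧ does (distinct? is) ∧ does (rainbow? cs)

  -- Extends the rainbow path is from l to r, which uses the colours cs, by k edges at either end.  The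
  -- results are only candidates: soundness rests on isRainbowPath.
  grow : ℕ → Partial → (l r : Label) → List Label → List Colour → List (List Label)
  grow zero    σ l r is cs = is ∷ []
  grow (suc k) σ l r is cs = concatMap step σ
    where
    fresh : Label → Bool
    fresh j = not (any (λ i → does (j Fin.≟ i)) is)
    towards : Label → Label → Colour → List (List Label)
    towards i j c =
      if fresh j
      then (if does (i Fin.≟ l) then grow k σ j r (j ∷ is) (c ∷ cs) else []) ++
           (if does (i Fin.≟ r) then grow k σ l j (is ++ j ∷ []) (c ∷ cs) else [])
      else []
    step : Label × Label × Colour → List (List Label)
    step (i , j , c) =
      if any (λ c′ → does (c Fin.≟ c′)) cs then [] else towards i j c ++ towards j i c

  -- Only paths through the edge just coloured are sought: a path completed by an earlier branching
  -- edge has already closed the branch there.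
  conflict : ℕ → Partial → Label → Label → Colour → Bool
  conflict zero    σ i j c = false
  conflict (suc k) σ i j c = any (isRainbowPath (suc k) σ) (grow k σ i j (i ∷ j ∷ []) (c ∷ []))

  Task : Set
  Task = Label × Label × List Colour

  freely : List (Label × Label) → List Task
  freely = map λ (i , j) → i , j , allFin 4

  -- Does every completion of the partial colouring, with each task (i , j , cs) colouring the edge ij from
  -- cs, contain a rainbow path of k edges or pass the test?
  search : ℕ → (Partial → Bool) → Partial → List Task → Bool
  search k test σ tasks = test σ ∨ branch tasks
    module Search where
    branch : List Task → Bool
    branch []                    = false
    branch ((i , j , cs) ∷ ts) =
      -- The extra edge of a start may be among the listed pairs; it then keeps its colour.
      if is-just (colourOf σ i j) then branch ts else
      all (λ c → conflict k ((i , j , c) ∷ σ) i j c ∨ search k test ((i , j , c) ∷ σ) ts) cs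

  -- Certificates hide the search, which would otherwise be normalised along with every goal that mentions it.
  data Passed (test : Partial → Bool) (σ : Partial) : Set where
    pass : T (test σ) → Passed test σ

  data Certified (k : ℕ) (test : Partial → Bool) (σ : Partial) (ts : List Task) : Set where
    certify : T (search k test σ ts) → Certified k test σ ts

-- Soundness of the search

module Colouring {V : Set} (χ : V → V → Colour) (χ-sym : ∀ u v → χ u v ≡ χ v u) where

  pathColours : List V → List Colour
  pathColours []           = []
  pathColours (u ∷ [])     = []
  pathColours (u ∷ v ∷ vs) = χ u v ∷ pathColours (v ∷ vs)

  RainbowPath : ℕ → Set
  RainbowPath k = ∃[ vs ] length vs ≡ suc k × Unique vs × Unique (pathColours vs)

  -- The labels stand for the vertices ρ i and the colour names for the colours κ c, so that searches
  -- can prescribe concrete labels and colour names.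
  module Frame {m : ℕ} (ρ : Fin m → V) (ρ-inj : Injective _≡_ _≡_ ρ)
               (κ : Colour → Colour) (κ-inj : Injective _≡_ _≡_ κ) where

    open PartialColouring m

    Coloured : Label → Label → Colour → Set
    Coloured i j c = χ (ρ i) (ρ j) ≡ κ c

    Valid : Partial → Set
    Valid = All λ (i , j , c) → Coloured i j c

    Sound : List Task → Set
    Sound = All λ (i , j , cs) → Any (Coloured i j) cs

    -- An injective renaming of the four colours is surjective, so the colour of every edge has a
    -- name.
    freely-sound : ∀ ijs → Sound (freely ijs)
    freely-sound ijs = All.map⁺ (All.universal sound ijs)
      where
      sound : ∀ ij → Any (Coloured (proj₁ ij) (proj₂ ij)) (allFin 4)
      sound (i , j) with c , eq ← injective⇒surjective κ-inj (χ (ρ i) (ρ j)) =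
        Any.map (λ c≡ → trans (sym eq) (cong κ c≡)) (∈-allFin c)

    colourOf-sound : ∀ {σ} → Valid σ → ∀ i j {c} → colourOf σ i j ≡ just c → Coloured i j c
    colourOf-sound {(a , b , _) ∷ _} (v ∷ vs) i j eq with same? i j a b
    colourOf-sound (v ∷ vs) i j refl | yes (inj₁ (refl , refl)) = v
    colourOf-sound (v ∷ vs) i j refl | yes (inj₂ (refl , refl)) = trans (χ-sym _ _) v
    ... | no _ = colourOf-sound vs i j eq

    known-sound : ∀ {σ} → Valid σ → ∀ i j {c} → T (known σ i j c) → Coloured i j c
    known-sound {σ} v i j {c} t with colourOf σ i j in eq
    ... | just c′ with c Fin.≟ c′
    ... | yes refl = colourOf-sound v i j eq

    coloursAlong-sound : ∀ {σ} → Valid σ → ∀ is {cs} → coloursAlong σ is ≡ just cs →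
                         pathColours (map ρ is) ≡ map κ cs
    coloursAlong-sound v []       refl = refl
    coloursAlong-sound v (i ∷ []) refl = refl
    coloursAlong-sound {σ} v (i ∷ j ∷ is) eq
      with colourOf σ i j in eq₁ | coloursAlong σ (j ∷ is) in eq₂
    coloursAlong-sound v (i ∷ j ∷ is) refl | just c | just cs =
      cong₂ _∷_ (colourOf-sound v i j eq₁) (coloursAlong-sound v (j ∷ is) eq₂)

    isRainbowPath-sound : ∀ {k σ} → Valid σ → ∀ is → T (isRainbowPath k σ is) → RainbowPath k
    isRainbowPath-sound {k} {σ} v is t with coloursAlong σ is in eq
    ... | just cs with len , t′ ← Equivalence.to T-∧ t with dis , rbw ← Equivalence.to T-∧ t′ =
      map ρ is ,
      trans (length-map ρ is) (T⇒ (length is ℕ.≟ suc k) len) ,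
      Unique.map⁺ ρ-inj (T⇒ (DecUnique.unique? Fin._≟_ is) dis) ,
      subst Unique (sym (coloursAlong-sound v is eq))
        (Unique.map⁺ κ-inj (T⇒ (DecUnique.unique? Fin._≟_ cs) rbw))

    conflict-sound : ∀ k {σ} → Valid σ → ∀ i j c → T (conflict k σ i j c) → RainbowPath k
    conflict-sound (suc k) v i j c t
      with is , t′ ← Any.satisfied (any⁻ (isRainbowPath (suc k) _) (grow k _ i j _ _) t) =
      isRainbowPath-sound v is t′

    -- Follow the branch that agrees with `χ`: its colour is among those offered by each task, so
    -- the branch ends in a conflict, which is an actual rainbow path, or in a partial colouring
    -- that passes the test.
    search-sound : ∀ k test {σ} → Valid σ → ∀ ts → Sound ts → T (search k test σ ts) →
                   RainbowPath k ⊎ ∃[ τ ] Valid τ × Passed test τ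
    branch-sound : ∀ k test {σ} → Valid σ → ∀ all-ts ts → Sound ts → T (Search.branch k test σ all-ts ts) →
                   RainbowPath k ⊎ ∃[ τ ] Valid τ × Passed test τ

    search-sound k test {σ} v ts s t with Equivalence.to T-∨ t
    ... | inj₁ t′ = inj₂ (σ , v , pass t′)
    ... | inj₂ t′ = branch-sound k test v ts ts s t′

    branch-sound k test {σ} v all-ts ((i , j , cs) ∷ ts) (any ∷ s) t with is-just (colourOf σ i j)
    ... | true  = branch-sound k test v all-ts ts s t
    ... | false with All.lookupAny (All.all⁺ _ cs t) any
    ... | t′ , eq with Equivalence.to T-∨ t′
    ... | inj₁ conf = inj₁ (conflict-sound k (eq ∷ v) i j _ conf)
    ... | inj₂ rec  = search-sound k test (eq ∷ v) ts s rec

    abstract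
      certified-sound : ∀ {k test σ ts} → Certified k test σ ts → Valid σ → Sound ts →
                        RainbowPath k ⊎ ∃[ τ ] Valid τ × Passed test τ
      certified-sound (certify t) v s = search-sound _ _ v _ s t

-- The certified searches

∀Fin : ∀ {n} → (Fin n → Bool) → Bool
∀Fin f = all f (allFin _)

∀Fin⁻ : ∀ {n} (f : Fin n → Bool) → T (∀Fin f) → ∀ i → T (f i)
∀Fin⁻ f t i = All.lookup (All.all⁺ f _ t) (∈-allFin i)

∃Fin⁻ : ∀ {n} (f : Fin n → Bool) → T (any f (allFin n)) → ∃[ i ] T (f i)
∃Fin⁻ f t = Any.satisfied (any⁻ f (allFin _) t)

unless : ∀ {P : Set} (P? : Dec P) b → T (does P? ∨ b) → ¬ P → T b
unless (yes p) _ _ ¬p = contradiction p ¬p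
unless (no _)  _ t _  = t

-- The labels 2, 3, 4 form a path with colours 2, 3, and some edge ij has colour 0.
module CherrySearch where
  open PartialColouring 5

  -- The edges 23 and 34 have colours 2 and 3, so the test marks a contradiction: the edge ij of
  -- colour 0 falls on the cherry.
  test : Partial → Bool
  test τ = known τ 2F 3F 0F ∨ known τ 3F 4F 0F

  decode : ∀ {τ} → Passed test τ → T (known τ 2F 3F 0F) ⊎ T (known τ 3F 4F 0F)
  decode (pass t) = Equivalence.to T-∨ t

  start : Label → Label → Partial
  start i j = (i , j , 0F) ∷ (2F , 3F , 2F) ∷ (3F , 4F , 3F) ∷ []

  pairs : List (Label × Label)
  pairs = (2F , 4F) ∷ (0F , 1F) ∷ (0F , 2F) ∷ (0F , 3F) ∷ (0F , 4F) ∷ (1F , 2F) ∷ (1F , 3F) ∷ (1F , 4F) ∷ []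

  check : Label → Label → Bool
  check i j = does (i Fin.≟ j) ∨ search 3 test (start i j) (freely pairs)

  abstract
    certified : ∀ {i j} → i ≢ j → Certified 3 test (start i j) (freely pairs)
    certified {i} {j} i≢j = certify (unless (i Fin.≟ j) (search 3 test (start i j) (freely pairs))
      (∀Fin⁻ (check i) (∀Fin⁻ (λ i → ∀Fin (check i)) _ i) j) i≢j)

-- The labels 3, 4, 5, 6 form a path with colours 1, 2, 3, and some edge among 2, …, 6 has colour 0.  The
-- vertices 0 and 1 are arbitrary.
module FourthColourSearch where
  open PartialColouring 7

  agree : Partial → Colour → Bool
  agree τ c = known τ 2F 0F c ∧ known τ 2F 1F c ∧ known τ 0F 1F c

  -- The first group of alternatives marks a contradiction, where the edge of colour 0 falls on the
  -- path. Otherwise the triangle 0, 1, 2 must be monochromatic.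
  test : Partial → Bool
  test τ = (known τ 3F 4F 0F ∨ known τ 4F 5F 0F ∨ known τ 5F 6F 0F) ∨ any (agree τ) (allFin 4)

  decode : ∀ {τ} → Passed test τ →
           (T (known τ 3F 4F 0F) ⊎ T (known τ 4F 5F 0F) ⊎ T (known τ 5F 6F 0F)) ⊎
           ∃[ c ] T (known τ 2F 0F c) × T (known τ 2F 1F c) × T (known τ 0F 1F c)
  decode {τ} (pass t) with Equivalence.to T-∨ t
  ... | inj₁ clash = inj₁ (map₂ (Equivalence.to T-∨) (Equivalence.to T-∨ clash))
  ... | inj₂ found with c , t₁ ← ∃Fin⁻ (agree τ) found with t₂ , t₃ ← Equivalence.to T-∧ t₁ =
    inj₂ (c , t₂ , Equivalence.to T-∧ t₃)

  start : Label → Label → Partial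
  start i j = (i , j , 0F) ∷ (3F , 4F , 1F) ∷ (4F , 5F , 2F) ∷ (5F , 6F , 3F) ∷ []

  -- This order keeps the search tree small.
  pairs : List (Label × Label)
  pairs =
    (6F , 1F) ∷ (6F , 2F) ∷ (3F , 1F) ∷ (4F , 1F) ∷ (3F , 2F) ∷ (2F , 1F) ∷ (2F , 0F) ∷ (0F , 1F) ∷ (5F , 2F) ∷
    (3F , 5F) ∷ (3F , 0F) ∷ (4F , 0F) ∷ (3F , 6F) ∷ (5F , 0F) ∷ (5F , 1F) ∷ (4F , 6F) ∷ (4F , 2F) ∷ (6F , 0F) ∷ []

  check : Fin 5 → Fin 5 → Bool
  check i j = does (j Fin.≤? i) ∨ search 4 test (start (suc (suc i)) (suc (suc j))) (freely pairs)

  abstract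
    certified : ∀ {i j} → i Fin.< j → Certified 4 test (start (suc (suc i)) (suc (suc j))) (freely pairs)
    certified {i} {j} i<j = certify (unless (j Fin.≤? i) (search 4 test (start (suc (suc i)) (suc (suc j))) (freely pairs))
      (∀Fin⁻ (check i) (∀Fin⁻ (λ i → ∀Fin (check i)) _ i) j) (ℕ.<⇒≱ i<j))

-- Colour 2 dominates on six vertices: the pairs {0, 1}, {2, 3} and {4, 5} have a colour of their own,
-- and all other edges have colour 2.
own : Fin 6 → Colour
own 0F = 0F
own 1F = 0F
own 2F = 1F
own 3F = 1F
own 4F = 3F
own 5F = 3F

hue : Fin 6 → Fin 6 → Colour
hue i j = if does (own i Fin.≟ own j) then own i else 2F

-- The edge 01 has colour 0 and is disjoint from the path 2, 3, 4, 5 with colours 1, 2, 3, none of whose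
-- vertices meets colour 0.
module DisjointEdgeSearch where
  open PartialColouring 6

  test : Partial → Bool
  test τ = ∀Fin λ i → ∀Fin λ j → does (i Fin.≟ j) ∨ known τ i j (hue i j)

  decode : ∀ {τ} → Passed test τ → ∀ {i j} → i ≢ j → T (known τ i j (hue i j))
  decode {τ} (pass t) {i} {j} = unless (i Fin.≟ j) (known τ i j (hue i j))
    (∀Fin⁻ (at i) (∀Fin⁻ (λ i → ∀Fin (at i)) t i) j)
    where
    at : Label → Label → Bool
    at i j = does (i Fin.≟ j) ∨ known τ i j (hue i j)

  start : Partial
  start = (0F , 1F , 0F) ∷ (2F , 3F , 1F) ∷ (3F , 4F , 2F) ∷ (4F , 5F , 3F) ∷ []

  pairs : List (Label × Label)
  pairs = (0F , 3F) ∷ (0F , 4F) ∷ (0F , 2F) ∷ (0F , 5F) ∷ (1F , 3F) ∷ (1F , 4F) ∷ (1F , 2F) ∷ (1F , 5F) ∷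
    (2F , 4F) ∷ (3F , 5F) ∷ (2F , 5F) ∷ []

  without0 : Label × Label → Task
  without0 (i , j) = i , j , 1F ∷ 2F ∷ 3F ∷ []

  tasks : List Task
  tasks = map without0 pairs

  -- Each listed pair has its second end on the path, which justifies withholding colour 0 from it.
  pairs-end : All (λ (i , j) → ∃[ k ] j ≡ suc (suc k) × i ≢ j) pairs
  pairs-end = toWitness {a? = All.all? (λ (i , j) → Fin.any? λ k → (j Fin.≟ suc (suc k)) ×-dec ¬? (i Fin.≟ j)) pairs} _

  abstract
    certified : Certified 4 test start tasks
    certified = certify _

-- The labels old l carry the colouring above, and the edges at the vertex new are compared.
module Extension (m : ℕ) (new : Fin m) (old : Fin 6 → Fin m) where
  open PartialColouring m

  increasing : List (Fin 6 × Fin 6)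
  increasing = filter (λ (i , j) → i Fin.<? j) (cartesianProduct (allFin 6) (allFin 6))

  edge : Fin 6 × Fin 6 → Label × Label × Colour
  edge (i , j) = old i , old j , hue i j

  start : Partial
  start = map edge increasing

  -- This is domination by colour 2 at the vertex `new`, tested on i and j alone and stated
  -- positively, so that known colours can establish it.
  compatible : Label → Label → Partial → Bool
  compatible i j τ = known τ new i 2F ∨ known τ new j 2F ∨ any (λ c → known τ new i c ∧ known τ new j c) (allFin 4)

  compatible⁻ : ∀ i j {τ} → T (compatible i j τ) →
                T (known τ new i 2F) ⊎ T (known τ new j 2F) ⊎ ∃[ c ] T (known τ new i c) × T (known τ new j c)
  compatible⁻ i j {τ} t = map₂ (map₂ common ∘ Equivalence.to T-∨) (Equivalence.to T-∨ t)
    where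
    common : T (any (λ c → known τ new i c ∧ known τ new j c) (allFin 4)) → ∃[ c ] T (known τ new i c) × T (known τ new j c)
    common found with c , both ← ∃Fin⁻ (λ c → known τ new i c ∧ known τ new j c) found = c , Equivalence.to T-∧ both

  spokes : Label → List (Label × Label)
  spokes i = map (λ l → i , old l) (allFin 6)

module OneOutsideSearch where
  open Extension 7 0F suc public
  open PartialColouring 7

  -- Domination at the old vertices comes from this: the edge from a vertex outside to l has colour
  -- 2 or the colour of the pair containing l.
  ownOr2 : Partial → Fin 6 → Bool
  ownOr2 τ l = known τ 0F (suc l) 2F ∨ known τ 0F (suc l) (own l)

  test : Partial → Bool
  test τ = ∀Fin λ l → ownOr2 τ l ∧ ∀Fin λ l′ → compatible (suc l) (suc l′) τ

  decode : ∀ {τ} → Passed test τ → ∀ l → (T (known τ 0F (suc l) 2F) ⊎ T (known τ 0F (suc l) (own l))) ×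
           ∀ l′ → T (compatible (suc l) (suc l′) τ)
  decode {τ} (pass t) l
    with t₁ , t₂ ← Equivalence.to T-∧ (∀Fin⁻ (λ l → ownOr2 τ l ∧ ∀Fin (λ l′ → compatible (suc l) (suc l′) τ)) t l) =
    Equivalence.to T-∨ t₁ , ∀Fin⁻ (λ l′ → compatible (suc l) (suc l′) τ) t₂

  abstract
    certified : Certified 4 test start (freely (spokes 0F))
    certified = certify _

module TwoOutsideSearch where
  open Extension 8 0F (λ l → suc (suc l)) public
  open PartialColouring 8

  test : Partial → Bool
  test τ = ∀Fin λ l → compatible 1F (suc (suc l)) τ

  decode : ∀ {τ} → Passed test τ → ∀ l → T (compatible 1F (suc (suc l)) τ)
  decode {τ} (pass t) = ∀Fin⁻ (λ l → compatible 1F (suc (suc l)) τ) t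

  abstract
    certified : Certified 4 test start (freely ((0F , 1F) ∷ spokes 0F))
    certified = certify _

module ThreeOutsideSearch where
  open Extension 9 0F (λ l → suc (suc (suc l))) public
  open PartialColouring 9

  test : Partial → Bool
  test = compatible 1F 2F

  decode : ∀ {τ} → Passed test τ → T (compatible 1F 2F τ)
  decode (pass t) = t

  -- The labels 3, 5, 7 represent the three pairs of the old six vertices; the edges to these
  -- representatives already force the outcome.
  pairs : List (Label × Label)
  pairs = (0F , 1F) ∷ (0F , 2F) ∷ (1F , 3F) ∷ (1F , 5F) ∷ (1F , 7F) ∷ (2F , 3F) ∷ (2F , 5F) ∷ (2F , 7F) ∷ []

  abstract
    certified : Certified 4 test start (freely pairs)
    certified = certify _

-- Colourings without a rainbow path on five vertices

module _ {n : ℕ} where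

  open DecMembership (Fin._≟_ {n}) using (_∈?_)

  injective-∈⇒≤ : ∀ {m} {f : Fin m → Fin n} → Injective _≡_ _≡_ f →
                  ∀ {xs} → (∀ i → f i ∈ xs) → m ≤ length xs
  injective-∈⇒≤ f-inj {xs} f∈ = Fin.injective⇒≤ {f = λ i → Any.index (f∈ i)} λ {i} {j} eq →
    f-inj (trans (lookup-index (f∈ i)) (trans (cong (lookup xs) eq) (sym (lookup-index (f∈ j)))))

  fresh : ∀ (vs : List (Fin n)) → length vs < n → ∃[ w ] w ∉ vs
  fresh vs vs<n = decidable-stable (Fin.any? λ w → ¬? (w ∈? vs)) λ none →
    ℕ.<⇒≱ vs<n (injective-∈⇒≤ (λ eq → eq) λ w → decidable-stable (w ∈? vs) λ w∉ → none (w , w∉))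

  ∉⇒Unique : ∀ {v : Fin n} {vs} → v ∉ vs → Unique vs → Unique (v ∷ vs)
  ∉⇒Unique v∉ vs! = All.¬Any⇒All¬ _ v∉ ∷ vs!

  ∉⇒Unique₂ : ∀ {u v : Fin n} {vs} → u ≢ v → u ∉ vs → v ∉ vs → Unique vs → Unique (u ∷ v ∷ vs)
  ∉⇒Unique₂ u≢v u∉ v∉ vs! = (u≢v ∷ All.¬Any⇒All¬ _ u∉) ∷ ∉⇒Unique v∉ vs!

  -- An entry of xs that already occurs is traded for a fresh element, so exactly `length xs`
  -- elements are added even if entries coincide. This gives every frame a fixed number of labels,
  -- and repeated entries can serve as requests for fresh elements.
  cover : ∀ xs {vs : List (Fin n)} → Unique vs → length xs + length vs ≤ n →
          ∃[ us ] length us ≡ length xs × Unique (us ++ vs) × All (_∈ us ++ vs) xs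
  cover []       vs! _  = [] , refl , vs! , []
  cover (x ∷ xs) {vs} vs! le with cover xs vs! (ℕ.<⇒≤ le)
  ... | us , len , us! , xs∈ with x ∈? (us ++ vs)
  ... | no x∉  = x ∷ us , cong suc len , ∉⇒Unique x∉ us! , here refl ∷ All.map there xs∈
  ... | yes x∈ with fresh (us ++ vs) (subst (_< n) (sym (trans (length-++ us) (cong (_+ length vs) len))) le)
  ... | w , w∉ = w ∷ us , cong suc len , ∉⇒Unique w∉ us! , there x∈ ∷ All.map there xs∈

-- Abstract, since with-abstractions would otherwise unfold cover.
abstract

  palette₁ : ∀ (c : Colour) → ∃₂ λ p q → ∃[ s ] Unique (p ∷ q ∷ s ∷ c ∷ [])
  palette₁ c with cover (c ∷ c ∷ c ∷ []) ([] ∷ []) ℕ.≤-refl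
  ... | p ∷ q ∷ s ∷ [] , refl , us! , _ = p , q , s , us!

  palette₂ : ∀ {p q : Colour} → p ≢ q →
             Σ (Colour → Colour) λ κ → Injective _≡_ _≡_ κ × κ 2F ≡ p × κ 3F ≡ q
  palette₂ {p} {q} p≢q with cover (p ∷ p ∷ []) ((p≢q ∷ []) ∷ [] ∷ []) ℕ.≤-refl
  ... | y ∷ z ∷ [] , refl , us! , _ = lookup (y ∷ z ∷ p ∷ q ∷ []) , lookup-injective us! , refl , refl

  palette₃ : ∀ {p q s : Colour} → Unique (p ∷ q ∷ s ∷ []) →
             Σ (Colour → Colour) λ κ → Injective _≡_ _≡_ κ × κ 1F ≡ p × κ 2F ≡ q × κ 3F ≡ s
  palette₃ {p} {q} {s} pqs! with cover (p ∷ []) pqs! ℕ.≤-refl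
  ... | z ∷ [] , refl , us! , _ = lookup (z ∷ p ∷ q ∷ s ∷ []) , lookup-injective us! , refl , refl , refl

module _ {n : ℕ} (χ : Fin n → Fin n → Colour) (χ-sym : ∀ u v → χ u v ≡ χ v u) where

  open Colouring χ χ-sym
  open DecMembership (Fin._≟_ {n}) using (_∈?_)

  private
    V : Set
    V = Fin n

  Exact : Set
  Exact = ∀ c → ∃₂ λ u v → u ≢ v × χ u v ≡ c

  -- Take edges ab and cd of colours 0 and 1. If a = c they form a cherry. Otherwise ac differs in
  -- colour from cd, if it has colour 0, or else from ab.
  cherry : Exact → ∃[ x ] ∃[ v ] ∃[ y ] Unique (x ∷ v ∷ y ∷ []) × χ x v ≢ χ v y
  cherry exact with exact 0F | exact 1F
  ... | a , b , a≢b , ab | c , d , c≢d , cd with a Fin.≟ c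
  ... | yes refl = b , a , d , (≢-sym a≢b ∷ b≢d ∷ []) ∷ (c≢d ∷ []) ∷ [] ∷ [] , ba≢ad
    where
    ba≢ad : χ b a ≢ χ a d
    ba≢ad eq = case trans (sym ab) (trans (χ-sym a b) (trans eq cd)) of λ ()
    b≢d : b ≢ d
    b≢d refl = ba≢ad (χ-sym b a)
  ... | no a≢c with χ a c Fin.≟ 0F
  ... | yes ac = a , c , d , (a≢c ∷ a≢d ∷ []) ∷ (c≢d ∷ []) ∷ [] ∷ [] , ac≢cd
    where
    ac≢cd : χ a c ≢ χ c d
    ac≢cd eq = case trans (sym ac) (trans eq cd) of λ ()
    a≢d : a ≢ d
    a≢d refl = ac≢cd (χ-sym a c)
  ... | no ac≢0 = b , a , c , (≢-sym a≢b ∷ b≢c ∷ []) ∷ (a≢c ∷ []) ∷ [] ∷ [] , ba≢ac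
    where
    ba≢ac : χ b a ≢ χ a c
    ba≢ac eq = ac≢0 (trans (sym eq) (trans (χ-sym b a) ab))
    b≢c : b ≢ c
    b≢c refl = ba≢ac (χ-sym b a)

  module Labelled (vs : List V) (vs! : Unique vs) (κ : Colour → Colour) (κ-inj : Injective _≡_ _≡_ κ) where
    open Frame (lookup vs) (lookup-injective vs!) κ κ-inj public

  -- A cherry in two colours and an edge of a third colour fit on five common vertices, where
  -- `CherrySearch` always finds the path.
  rainbowPath₃ : Exact → 5 ≤ n → RainbowPath 3
  rainbowPath₃ exact 5≤n with cherry exact
  ... | x , v , y , xvy! , xv≢vy with palette₂ xv≢vy
  ... | κ , κ-inj , κ2 , κ3 with exact (κ 0F)
  ... | g , h , g≢h , gh with cover (g ∷ h ∷ []) xvy! 5≤n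
  ... | us@(_ ∷ _ ∷ []) , refl , us! , g∈ ∷ h∈ ∷ [] =
    conclude (certified-sound (certified i≢j) start-valid (freely-sound pairs))
    where
    open CherrySearch
    open PartialColouring 5
    open Labelled (us ++ x ∷ v ∷ y ∷ []) us! κ κ-inj

    i j : Label
    i = Any.index g∈
    j = Any.index h∈

    i≢j : i ≢ j
    i≢j eq = g≢h (trans (lookup-index g∈) (trans (cong (lookup _) eq) (sym (lookup-index h∈))))

    start-valid : Valid (start i j)
    start-valid = trans (cong₂ χ (sym (lookup-index g∈)) (sym (lookup-index h∈))) gh ∷ sym κ2 ∷ sym κ3 ∷ []

    conclude : RainbowPath 3 ⊎ (∃[ τ ] Valid τ × Passed test τ) → RainbowPath 3
    conclude (inj₁ rainbow) = rainbow
    conclude (inj₂ (τ , valid , passed)) with decode passed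
    ... | inj₁ t = case κ-inj (trans κ2 (known-sound valid 2F 3F t)) of λ ()
    ... | inj₂ t = case κ-inj (trans κ3 (known-sound valid 3F 4F t)) of λ ()

  NearlyMonochromatic : Set
  NearlyMonochromatic = ∃[ vs ] length vs ≡ 4 × Unique vs × ∃[ c ] ∀ p q → p ≢ q → p ∉ vs → q ∉ vs → χ p q ≡ c

  Dominated : Set
  Dominated = ∃[ c ] ∀ v p q → v ≢ p → v ≢ q → χ v p ≢ c → χ v q ≢ c → χ v p ≡ χ v q

  module _ (no-rainbow : ¬ RainbowPath 4) (6≤n : 6 ≤ n) where

    module RainbowPath₃ {a b c d : V} (abcd! : Unique (a ∷ b ∷ c ∷ d ∷ []))
             (κ : Colour → Colour) (κ-inj : Injective _≡_ _≡_ κ)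
             (ab : χ a b ≡ κ 1F) (bc : χ b c ≡ κ 2F) (cd : χ c d ≡ κ 3F) where

      abcd : List V
      abcd = a ∷ b ∷ c ∷ d ∷ []

      module FourthColour {e : V} (eabcd! : Unique (e ∷ abcd)) {i j : Fin 5} (i<j : i Fin.< j)
               (ij : χ (lookup (e ∷ abcd) i) (lookup (e ∷ abcd) j) ≡ κ 0F) where

        open FourthColourSearch

        -- The labels 0 and 1 of the search stand for p and q, and 2 for e. Every outcome other than
        -- a monochromatic triangle gives a path edge a second colour.
        flat : ∀ {p q} → Unique (p ∷ q ∷ e ∷ abcd) → χ e p ≡ χ e q × χ p q ≡ χ e q
        flat {p} {q} pq! = conclude (certified-sound (certified i<j) (ij ∷ ab ∷ bc ∷ cd ∷ []) (freely-sound pairs))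
          where
          open PartialColouring 7
          open Labelled (p ∷ q ∷ e ∷ abcd) pq! κ κ-inj

          decoded : ∀ {τ} → Valid τ →
                    (T (known τ 3F 4F 0F) ⊎ T (known τ 4F 5F 0F) ⊎ T (known τ 5F 6F 0F)) ⊎
                    (∃[ h ] T (known τ 2F 0F h) × T (known τ 2F 1F h) × T (known τ 0F 1F h)) →
                    χ e p ≡ χ e q × χ p q ≡ χ e q
          decoded valid (inj₁ (inj₁ t))        = case κ-inj (trans (sym (known-sound valid 3F 4F t)) ab) of λ ()
          decoded valid (inj₁ (inj₂ (inj₁ t))) = case κ-inj (trans (sym (known-sound valid 4F 5F t)) bc) of λ ()
          decoded valid (inj₁ (inj₂ (inj₂ t))) = case κ-inj (trans (sym (known-sound valid 5F 6F t)) cd) of λ ()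
          decoded valid (inj₂ (h , t₁ , t₂ , t₃)) =
            trans (known-sound valid 2F 0F t₁) (sym (known-sound valid 2F 1F t₂)) ,
            trans (known-sound valid 0F 1F t₃) (sym (known-sound valid 2F 1F t₂))

          conclude : RainbowPath 4 ⊎ (∃[ τ ] Valid τ × Passed test τ) → χ e p ≡ χ e q × χ p q ≡ χ e q
          conclude (inj₁ rainbow)              = contradiction rainbow no-rainbow
          conclude (inj₂ (τ , valid , passed)) = decoded valid (decode passed)

        -- A sixth vertex f fixes the colour: `flat` compares every edge at e with ef, and every
        -- other edge pq with the edges from e to its ends.
        nearlyMonochromatic : NearlyMonochromatic
        nearlyMonochromatic with f , f∉ ← fresh (e ∷ abcd) 6≤n = abcd , refl , abcd! , χ e f , monochromatic
          where
          outside : ∀ {p q} → p ≢ q → p ∉ e ∷ abcd → q ∉ e ∷ abcd → Unique (p ∷ q ∷ e ∷ abcd)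
          outside p≢q p∉ q∉ = ∉⇒Unique₂ p≢q p∉ q∉ eabcd!

          ∉-∷ : ∀ {p} → p ≢ e → p ∉ abcd → p ∉ e ∷ abcd
          ∉-∷ p≢e p∉ (here p≡e)  = p≢e p≡e
          ∉-∷ p≢e p∉ (there p∈) = p∉ p∈

          spoke : ∀ p → p ∉ e ∷ abcd → χ e p ≡ χ e f
          spoke p p∉ with p Fin.≟ f
          ... | yes refl = refl
          ... | no p≢f   = proj₁ (flat (outside p≢f p∉ f∉))

          monochromatic : ∀ p q → p ≢ q → p ∉ abcd → q ∉ abcd → χ p q ≡ χ e f
          monochromatic p q p≢q p∉ q∉ with p Fin.≟ e | q Fin.≟ e
          ... | yes refl | _        = spoke q (∉-∷ (≢-sym p≢q) q∉)
          ... | no _     | yes refl = trans (χ-sym p q) (spoke p (∉-∷ p≢q p∉))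
          ... | no p≢e   | no q≢e   =
            trans (proj₂ (flat (outside p≢q (∉-∷ p≢e p∉) (∉-∷ q≢e q∉)))) (spoke q (∉-∷ q≢e q∉))

      -- The fifth vertex e is w, or any fresh vertex if w lies on the path. Either way sw is an
      -- edge among e, a, b, c, d; the comparison of positions only orients it.
      touching : ∀ {s w} → s ∈ abcd → s ≢ w → χ s w ≡ κ 0F → NearlyMonochromatic
      touching {s} {w} s∈ s≢w sw with cover (w ∷ []) abcd! (ℕ.<⇒≤ 6≤n)
      ... | e ∷ [] , refl , eabcd! , w∈ ∷ [] with Fin.<-cmp (suc (Any.index s∈)) (Any.index w∈)
      ... | tri< i<j _ _ = FourthColour.nearlyMonochromatic eabcd! i<j
        (trans (cong₂ χ (sym (lookup-index s∈)) (sym (lookup-index w∈))) sw)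
      ... | tri≈ _ i≡j _ = contradiction
        (trans (lookup-index s∈) (trans (cong (lookup (e ∷ abcd)) i≡j) (sym (lookup-index w∈)))) s≢w
      ... | tri> _ _ j<i = FourthColour.nearlyMonochromatic eabcd! j<i
        (trans (cong₂ χ (sym (lookup-index w∈)) (sym (lookup-index s∈))) (trans (χ-sym w s) sw))

      module Disjoint {x y : V} (six! : Unique (x ∷ y ∷ abcd)) (xy : χ x y ≡ κ 0F)
               (untouched : ∀ {s w} → s ∈ abcd → s ≢ w → χ s w ≢ κ 0F) where

        six : List V
        six = x ∷ y ∷ abcd

        Hued : Set
        Hued = ∀ i j → i ≢ j → χ (lookup six i) (lookup six j) ≡ κ (hue i j)

        -- The search shows that without a rainbow path the colouring of these six vertices is
        -- forced.
        hued : Hued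
        hued with Labelled.certified-sound _ six! κ κ-inj DisjointEdgeSearch.certified (xy ∷ ab ∷ bc ∷ cd ∷ []) sound
          where
          open Labelled _ six! κ κ-inj
          restricted : ∀ i j → lookup six j ∈ abcd → i ≢ j → Any (Coloured i j) (1F ∷ 2F ∷ 3F ∷ [])
          restricted i j j∈ i≢j with injective⇒surjective κ-inj (χ (lookup six i) (lookup six j))
          ... | 0F , eq = contradiction (trans (χ-sym _ _) (sym eq)) (untouched j∈ λ eq′ → i≢j (lookup-injective six! (sym eq′)))
          ... | 1F , eq = here (sym eq)
          ... | 2F , eq = there (here (sym eq))
          ... | 3F , eq = there (there (here (sym eq)))
          sound : Sound DisjointEdgeSearch.tasks
          sound = All.map⁺ {f = DisjointEdgeSearch.without0}
            (All.map (λ { {i , _} (j , refl , i≢j) → restricted i (suc (suc j)) (∈-lookup j) i≢j })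
              DisjointEdgeSearch.pairs-end)
        ... | inj₁ rainbow         = contradiction rainbow no-rainbow
        ... | inj₂ (τ , valid , t) = λ i j i≢j → Labelled.known-sound _ six! κ κ-inj valid i j (DisjointEdgeSearch.decode t i≢j)

        Compatible : V → V → V → Set
        Compatible v p q = χ v p ≡ κ 2F ⊎ χ v q ≡ κ 2F ⊎ χ v p ≡ χ v q

        module Extended {m : ℕ} {new : Fin m} {old : Fin 6 → Fin m} (ρ : Fin m → V) (ρ-inj : Injective _≡_ _≡_ ρ)
                 (ρ-old : ∀ (l : Fin 6) → ρ (old l) ≡ lookup six l) where
          open PartialColouring m
          open Frame ρ ρ-inj κ κ-inj public
          open Extension m new old

          start-valid : Valid start
          start-valid = All.map⁺ {f = edge} (All.map (λ { {i , j} i<j → valid i j (Fin.<⇒≢ i<j) })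
            (All.all-filter (λ (i , j) → i Fin.<? j) (cartesianProduct (allFin 6) (allFin 6))))
            where
            valid : ∀ i j → i ≢ j → Coloured (old i) (old j) (hue i j)
            valid i j i≢j = trans (cong₂ χ (ρ-old i) (ρ-old j)) (hued i j i≢j)

          compatible-sound : ∀ {τ} → Valid τ → ∀ i j → T (compatible i j τ) → Compatible (ρ new) (ρ i) (ρ j)
          compatible-sound {τ} valid i j t with compatible⁻ i j {τ} t
          ... | inj₁ t₁                   = inj₁ (known-sound valid new i t₁)
          ... | inj₂ (inj₁ t₁)            = inj₂ (inj₁ (known-sound valid new j t₁))
          ... | inj₂ (inj₂ (c , t₁ , t₂)) = inj₂ (inj₂ (trans (known-sound valid new i {c} t₁) (sym (known-sound valid new j t₂))))

        compatible-sym : ∀ {v p q} → Compatible v p q → Compatible v q p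
        compatible-sym (inj₁ vp)        = inj₂ (inj₁ vp)
        compatible-sym (inj₂ (inj₁ vq)) = inj₁ vq
        compatible-sym (inj₂ (inj₂ eq)) = inj₂ (inj₂ (sym eq))

        OwnOr2 : V → Fin 6 → Set
        OwnOr2 v l = χ v (lookup six l) ≡ κ 2F ⊎ χ v (lookup six l) ≡ κ (own l)

        one-outside : ∀ {v} → v ∉ six → ∀ l → OwnOr2 v l × ∀ l′ → Compatible v (lookup six l) (lookup six l′)
        one-outside {v} v∉ = conclude (certified-sound certified start-valid (freely-sound (spokes 0F)))
          where
          open OneOutsideSearch
          open PartialColouring 7
          v! = ∉⇒Unique v∉ six!
          open Extended {7} {0F} {suc} (lookup (v ∷ six)) (lookup-injective v!) (λ _ → refl)

          conclude : RainbowPath 4 ⊎ (∃[ τ ] Valid τ × Passed test τ) →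
                     ∀ l → OwnOr2 v l × ∀ l′ → Compatible v (lookup six l) (lookup six l′)
          conclude (inj₁ rainbow) = contradiction rainbow no-rainbow
          conclude (inj₂ (τ , valid , t)) l =
            ownOr2-sound (proj₁ (decode t l)) ,
            λ l′ → compatible-sound valid (suc l) (suc l′) (proj₂ (decode t l) l′)
            where
            ownOr2-sound : T (known τ 0F (suc l) 2F) ⊎ T (known τ 0F (suc l) (own l)) → OwnOr2 v l
            ownOr2-sound (inj₁ t) = inj₁ (known-sound valid 0F (suc l) t)
            ownOr2-sound (inj₂ t) = inj₂ (known-sound valid 0F (suc l) t)

        two-outside : ∀ {v p} → Unique (v ∷ p ∷ six) → ∀ l → Compatible v p (lookup six l)
        two-outside {v} {p} vp! = conclude (certified-sound certified start-valid (freely-sound ((0F , 1F) ∷ spokes 0F)))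
          where
          open TwoOutsideSearch
          open PartialColouring 8
          open Extended {8} {0F} {λ l → suc (suc l)} (lookup (v ∷ p ∷ six)) (lookup-injective vp!) (λ _ → refl)

          conclude : RainbowPath 4 ⊎ (∃[ τ ] Valid τ × Passed test τ) → ∀ l → Compatible v p (lookup six l)
          conclude (inj₁ rainbow) = contradiction rainbow no-rainbow
          conclude (inj₂ (τ , valid , t)) l =
            compatible-sound valid 1F (suc (suc l)) (decode t l)

        three-outside : ∀ {v p q} → Unique (v ∷ p ∷ q ∷ six) → Compatible v p q
        three-outside {v} {p} {q} vpq! = conclude (certified-sound certified start-valid (freely-sound pairs))
          where
          open ThreeOutsideSearch
          open PartialColouring 9
          open Extended {9} {0F} {λ l → suc (suc (suc l))} (lookup (v ∷ p ∷ q ∷ six)) (lookup-injective vpq!) (λ _ → refl)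

          conclude : RainbowPath 4 ⊎ (∃[ τ ] Valid τ × Passed test τ) → Compatible v p q
          conclude (inj₁ rainbow) = contradiction rainbow no-rainbow
          conclude (inj₂ (τ , valid , t)) = compatible-sound valid 1F 2F (decode t)

        -- For v outside the six vertices this is part of `one-outside`; for v among them it is read
        -- off the forced colouring.
        inside : ∀ l {v} → v ≢ lookup six l → OwnOr2 v l
        inside l {v} v≢ with v ∈? six
        ... | no v∉  = proj₁ (one-outside v∉ l)
        ... | yes v∈ = subst (λ u → OwnOr2 u l) (sym (lookup-index v∈)) (cases (hued k l k≢l))
          where
          k : Fin 6
          k = Any.index v∈
          k≢l : k ≢ l
          k≢l refl = v≢ (lookup-index v∈)
          cases : χ (lookup six k) (lookup six l) ≡ κ (hue k l) → OwnOr2 (lookup six k) l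
          cases eq with own k Fin.≟ own l
          ... | yes same = inj₂ (trans eq (cong κ same))
          ... | no _     = inj₁ eq

        -- By `inside`, the only colour besides the dominating one at the vertex labelled l is that
        -- of its own pair.
        compatible-inside : ∀ l {p q} → p ≢ lookup six l → q ≢ lookup six l → Compatible (lookup six l) p q
        compatible-inside l p≢ q≢ with inside l p≢ | inside l q≢
        ... | inj₁ eq | _        = inj₁ (trans (χ-sym _ _) eq)
        ... | inj₂ _  | inj₁ eq  = inj₂ (inj₁ (trans (χ-sym _ _) eq))
        ... | inj₂ eq | inj₂ eq′ = inj₂ (inj₂ (trans (χ-sym _ _) (trans eq (trans (sym eq′) (χ-sym _ _)))))

        -- The number of vertices among v, p, q outside the six selects the search. Three outside
        -- vertices need distinct labels, so p = q is treated apart.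
        compatible-outside : ∀ {v p q} → v ∉ six → v ≢ p → v ≢ q → Compatible v p q
        compatible-outside {v} {p} {q} v∉ v≢p v≢q with p ∈? six | q ∈? six
        ... | yes p∈ | yes q∈ rewrite lookup-index p∈ | lookup-index q∈ =
          proj₂ (one-outside v∉ (Any.index p∈)) (Any.index q∈)
        ... | no p∉  | yes q∈ = subst (Compatible v p) (sym (lookup-index q∈))
          (two-outside (∉⇒Unique₂ v≢p v∉ p∉ six!) (Any.index q∈))
        ... | yes p∈ | no q∉  = subst (λ p → Compatible v p q) (sym (lookup-index p∈))
          (compatible-sym (two-outside (∉⇒Unique₂ v≢q v∉ q∉ six!) (Any.index p∈)))
        ... | no p∉  | no q∉ with p Fin.≟ q
        ... | yes refl = inj₂ (inj₂ refl)
        ... | no p≢q   = three-outside ((v≢p ∷ v≢q ∷ All.¬Any⇒All¬ _ v∉) ∷ ∉⇒Unique₂ p≢q p∉ q∉ six!)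

        dominated : Dominated
        dominated = κ 2F , λ v p q v≢p v≢q vp≢ vq≢ → incompatible vp≢ vq≢ (compatible v≢p v≢q)
          where
          compatible : ∀ {v p q} → v ≢ p → v ≢ q → Compatible v p q
          compatible {v} {p} {q} v≢p v≢q with v ∈? six
          ... | no v∉  = compatible-outside v∉ v≢p v≢q
          ... | yes v∈ = subst (λ v → Compatible v p q) (sym v≡)
            (compatible-inside (Any.index v∈) (λ eq → v≢p (trans v≡ (sym eq))) (λ eq → v≢q (trans v≡ (sym eq))))
            where v≡ = lookup-index v∈

          incompatible : ∀ {v p q} → χ v p ≢ κ 2F → χ v q ≢ κ 2F → Compatible v p q → χ v p ≡ χ v q
          incompatible vp≢ _ (inj₁ vp)          = contradiction vp vp≢
          incompatible _ vq≢ (inj₂ (inj₁ vq))   = contradiction vq vq≢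
          incompatible _ _   (inj₂ (inj₂ vp≡vq)) = vp≡vq

    structure : Exact → NearlyMonochromatic ⊎ Dominated
    structure exact = extend (rainbowPath₃ exact (ℕ.<⇒≤ 6≤n))
      where
      extend : RainbowPath 3 → NearlyMonochromatic ⊎ Dominated
      extend (a ∷ b ∷ c ∷ d ∷ [] , refl , abcd! , colours!)
        with κ , κ-inj , κ1 , κ2 , κ3 ← palette₃ colours!
        with (Fin.any? λ s → Fin.any? λ w → (s ∈? (a ∷ b ∷ c ∷ d ∷ [])) ×-dec ¬? (s Fin.≟ w) ×-dec (χ s w Fin.≟ κ 0F))
      ... | yes (s , w , s∈ , s≢w , sw) = inj₁ (RainbowPath₃.touching abcd! κ κ-inj (sym κ1) (sym κ2) (sym κ3) s∈ s≢w sw)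
      -- Exactness provides an edge xy of the fourth colour. It is disjoint from the path, since no
      -- path vertex meets that colour.
      ... | no untouched with x , y , x≢y , xy ← exact (κ 0F) = inj₂ (RainbowPath₃.Disjoint.dominated
        abcd! κ κ-inj (sym κ1) (sym κ2) (sym κ3)
        (∉⇒Unique₂ x≢y
          (λ x∈ → untouched (x , y , x∈ , x≢y , xy))
          (λ y∈ → untouched (y , x , y∈ , ≢-sym x≢y , trans (χ-sym y x) xy)) abcd!)
        xy λ s∈ s≢w sw → untouched (_ , _ , s∈ , s≢w , sw))

-- Copies of P₅ and of S_t^r

flatten : ∀ {A : Set} → List (A × A) → List A
flatten []             = []
flatten ((a , b) ∷ ps) = a ∷ b ∷ flatten ps

module _ {n : ℕ} (Χ : EdgeColouring 4 (K n)) where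

  open EdgeColouring Χ renaming (colour to χ; colour-sym to χ-sym)
  open Colouring χ χ-sym

  private
    V : Set
    V = Fin n

  -- Up to orientation, each edge of `P 5` joins `inject₁ i` to `suc i` for a unique i, and its
  -- colour is entry i of `pathColours`, whose entries are distinct.
  rainbowPath⇒copy : RainbowPath 4 → ∃[ f ] Rainbow {G = P 5} Χ f
  rainbowPath⇒copy (vs@(_ ∷ _ ∷ _ ∷ _ ∷ _ ∷ []) , refl , vs! , colours!) = copy , rainbow
    where
    copy : Copy (P 5) (K n)
    copy = record
      { embed     = lookup vs
      ; injective = lookup-injective vs!
      ; preserves = λ {u} uv eq → Graph.irrefl (P 5) (lookup-injective vs! eq) uv
      }

    Step : (u v : Fin 5) → Fin 4 → Set
    Step u v i = u ≡ inject₁ i × v ≡ suc i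

    step : ∀ {u v} → toℕ v ≡ suc (toℕ u) → ∃ (Step u v)
    step {u} {suc i} eq = i , Fin.toℕ-injective (trans (sym (ℕ.suc-injective eq)) (sym (Fin.toℕ-inject₁ i))) , refl

    step-colour : ∀ {u v i} → Step u v i → χ (lookup vs u) (lookup vs v) ≡ lookup (pathColours vs) i
    step-colour {i = 0F} (refl , refl) = refl
    step-colour {i = 1F} (refl , refl) = refl
    step-colour {i = 2F} (refl , refl) = refl
    step-colour {i = 3F} (refl , refl) = refl

    steps : ∀ {u v x y} → ∃ (Step u v) → ∃ (Step x y) →
            χ (lookup vs u) (lookup vs v) ≡ χ (lookup vs x) (lookup vs y) → u ≡ x × v ≡ y
    steps (i , uv) (j , xy) eq = same
      (lookup-injective {xs = pathColours vs} colours! {i} {j} (trans (sym (step-colour uv)) (trans eq (step-colour xy)))) uv xy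
      where
      same : ∀ {u v x y i j} → i ≡ j → Step u v i → Step x y j → u ≡ x × v ≡ y
      same refl (refl , refl) (refl , refl) = refl , refl

    rainbow : Rainbow {G = P 5} Χ copy
    rainbow (inj₁ uv) (inj₁ xy) eq = inj₁ (steps (step uv) (step xy) eq)
    rainbow (inj₁ uv) (inj₂ yx) eq = inj₂ (steps (step uv) (step yx) (trans eq (χ-sym _ _)))
    rainbow (inj₂ vu) (inj₁ xy) eq with steps (step vu) (step xy) (trans (χ-sym _ _) eq)
    ... | refl , refl = inj₂ (refl , refl)
    rainbow (inj₂ vu) (inj₂ yx) eq with steps (step vu) (step yx) (trans (χ-sym _ _) (trans eq (χ-sym _ _)))
    ... | refl , refl = inj₁ (refl , refl)

  -- The structural results assume that there is no rainbow path; deciding its existence makes the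
  -- case distinction constructive.
  rainbowPath₄? : Dec (RainbowPath 4)
  rainbowPath₄? = map′
    (λ (a , b , c , d , e , vs! , colours!) → _ , refl , vs! , colours!)
    (λ { (a ∷ b ∷ c ∷ d ∷ e ∷ [] , refl , vs! , colours!) → a , b , c , d , e , vs! , colours! })
    (Fin.any? λ a → Fin.any? λ b → Fin.any? λ c → Fin.any? λ d → Fin.any? λ e →
      DecUnique.unique? Fin._≟_ (a ∷ b ∷ c ∷ d ∷ e ∷ []) ×-dec
      DecUnique.unique? Fin._≟_ (pathColours (a ∷ b ∷ c ∷ d ∷ e ∷ [])))

  MonochromaticStar : ℕ → ℕ → Set
  MonochromaticStar t r = ∃[ f ] Monochromatic {G = S t r} Χ f

  module _ {t r : ℕ} {c : Colour} where

    -- The list starts with the centre and then the two ends of each petal in turn, so positions 2m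
    -- + 1 and 2m + 2 match the `Added` edges. The copy uses the first t entries.
    flower : ∀ {x ps rest} → Unique (x ∷ flatten ps ++ rest) → length ps ≡ r → t ≤ suc (length (flatten ps ++ rest)) →
             All (λ v → χ x v ≡ c) (flatten ps ++ rest) → All (λ (a , b) → χ a b ≡ c) ps → MonochromaticStar t r
    flower {x} {ps} {rest} us! |ps|≡r t≤ spokes petals = copy , c , monochromatic
      where
      us : List V
      us = x ∷ flatten ps ++ rest

      copy : Copy (S t r) (K n)
      copy = record
        { embed     = λ i → lookup us (inject≤ i t≤)
        ; injective = λ eq → Fin.inject≤-injective t≤ t≤ _ _ (lookup-injective us! eq)
        ; preserves = λ uv eq →
            Graph.irrefl (S t r) (Fin.inject≤-injective t≤ t≤ _ _ (lookup-injective us! eq)) uv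
        }

      spoke : ∀ (i j : Fin (length us)) → toℕ i ≡ 0 → 0 < toℕ j → χ (lookup us i) (lookup us j) ≡ c
      spoke zero (suc j) _ _ = All.lookup spokes (∈-lookup j)

      petal : ∀ {ps : List (V × V)} {rest} → All (λ (a , b) → χ a b ≡ c) ps → ∀ m → m < length ps →
              (i j : Fin (length (flatten ps ++ rest))) → toℕ i ≡ 2 * m → toℕ j ≡ suc (2 * m) →
              χ (lookup (flatten ps ++ rest) i) (lookup (flatten ps ++ rest) j) ≡ c
      petal (ab ∷ _)   zero    _           zero            (suc zero)      _  _  = ab
      petal (_ ∷ abs)  (suc m) (s≤s m<)    i               j               i≡ j≡
        rewrite ℕ.+-suc m (m + 0) with i | j
      ... | suc (suc i) | suc (suc j) =
        petal abs m m< i j (ℕ.suc-injective (ℕ.suc-injective i≡)) (ℕ.suc-injective (ℕ.suc-injective j≡))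

      added : ∀ (m : Fin r) (i j : Fin (length us)) → toℕ i ≡ 1 + 2 * toℕ m → toℕ j ≡ 2 + 2 * toℕ m →
              χ (lookup us i) (lookup us j) ≡ c
      added m (suc i) (suc j) i≡ j≡ =
        petal petals (toℕ m) (subst (toℕ m <_) (sym |ps|≡r) (Fin.toℕ<n m)) i j (ℕ.suc-injective i≡) (ℕ.suc-injective j≡)

      directed : ∀ {i j} → Spoke t r i j ⊎ Added t r i j → χ (lookup us (inject≤ i t≤)) (lookup us (inject≤ j t≤)) ≡ c
      directed (inj₁ (i≡0 , 0<j))      =
        spoke _ _ (trans (Fin.toℕ-inject≤ _ t≤) i≡0) (subst (0 <_) (sym (Fin.toℕ-inject≤ _ t≤)) 0<j)
      directed (inj₂ (m , i≡ , j≡)) = added m _ _ (trans (Fin.toℕ-inject≤ _ t≤) i≡) (trans (Fin.toℕ-inject≤ _ t≤) j≡)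

      monochromatic : ∀ {i j} → Graph.Adj (S t r) i j → χ (lookup us (inject≤ i t≤)) (lookup us (inject≤ j t≤)) ≡ c
      monochromatic (inj₁ ij) = directed ij
      monochromatic (inj₂ ji) = trans (χ-sym _ _) (directed ji)

    pairUp : ∀ k (us : List V) → 2 * k ≤ length us → ∃₂ λ ps rest → length ps ≡ k × us ≡ flatten ps ++ rest
    pairUp zero    us _ = [] , us , refl , refl
    pairUp (suc k) us le rewrite ℕ.+-suc k (k + 0) with us | le
    ... | a ∷ b ∷ us | s≤s (s≤s le) with pairUp k us le
    ... | ps , rest , refl , refl = (a , b) ∷ ps , rest , refl , refl

    -- The first vertex serves as the centre and consecutive later vertices are paired into petals.
    clique : ∀ {us} → Unique us → AllPairs (λ p q → χ p q ≡ c) us → suc (2 * r) ≤ t → t ≤ length us → MonochromaticStar t r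
    clique []                   _             r≤ t≤ = case ℕ.≤-trans r≤ t≤ of λ ()
    clique {x ∷ us} us!@(_ ∷ _) (spokes ∷ mono) r≤ t≤ with pairUp r us (s≤s⁻¹ (ℕ.≤-trans r≤ t≤))
    ... | ps , rest , |ps|≡r , refl = flower us! |ps|≡r t≤ spokes (petals ps mono)
      where
      petals : ∀ ps → AllPairs (λ p q → χ p q ≡ c) (flatten ps ++ rest) → All (λ (a , b) → χ a b ≡ c) ps
      petals []       _                     = []
      petals (_ ∷ ps) ((ab ∷ _) ∷ _ ∷ mono) = ab ∷ petals ps mono

-- The lower bound

hueOf : Fin 3 → Fin 3 → Colour
hueOf i j with i Fin.≟ j
... | yes _ = inject₁ i
... | no _  = 3F

hueOf-same : ∀ i → hueOf i i ≡ inject₁ i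
hueOf-same i with i Fin.≟ i
... | yes _  = refl
... | no i≢i = contradiction refl i≢i

hueOf-sym : ∀ i j → hueOf i j ≡ hueOf j i
hueOf-sym i j with i Fin.≟ j | j Fin.≟ i
... | yes refl | yes _   = refl
... | yes refl | no j≢i  = contradiction refl j≢i
... | no i≢j   | yes j≡i = contradiction (sym j≡i) i≢j
... | no _     | no _    = refl

hueOf≢3⇒same : ∀ i j → hueOf i j ≢ 3F → i ≡ j
hueOf≢3⇒same i j hue≢3 with i Fin.≟ j
... | yes i≡j = i≡j
... | no _    = contradiction refl hue≢3

hueOf≡3⇒different : ∀ {i j} → hueOf i j ≡ 3F → i ≢ j
hueOf≡3⇒different {i} hue≡3 refl = Fin.fromℕ≢inject₁ (trans (sym hue≡3) (hueOf-same i))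

hues-along : Fin 3 → Fin 3 → Fin 3 → Fin 3 → Fin 3 → List Colour
hues-along i j k l m = hueOf i j ∷ hueOf j k ∷ hueOf k l ∷ hueOf l m ∷ []

-- Four distinct hues come from one edge inside each part and a single crossing edge.
no-rainbow-hues : ∀ i j k l m → ¬ Unique (hues-along i j k l m)
no-rainbow-hues = toWitness {a? = Fin.all? λ i → Fin.all? λ j → Fin.all? λ k → Fin.all? λ l → Fin.all? λ m →
  ¬? (DecUnique.unique? Fin._≟_ (hues-along i j k l m))} _

third : ∀ (i j k p : Fin 3) → j ≢ i → k ≢ i → j ≢ k → p ≢ i → p ≢ j → p ≡ k
third = toWitness {a? = Fin.all? λ i → Fin.all? λ j → Fin.all? λ k → Fin.all? λ p →
  ¬? (j Fin.≟ i) →-dec ¬? (k Fin.≟ i) →-dec ¬? (j Fin.≟ k) →-dec ¬? (p Fin.≟ i) →-dec ¬? (p Fin.≟ j) →-dec (p Fin.≟ k)} _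

⌊2*n/2⌋≡n : ∀ n → ⌊ 2 * n /2⌋ ≡ n
⌊2*n/2⌋≡n n = trans (cong (λ k → ⌊ n + k /2⌋) (ℕ.+-identityʳ n)) (sym (ℕ.n≡⌊n+n/2⌋ n))

⌊1+2*n/2⌋≡n : ∀ n → ⌊ 1 + 2 * n /2⌋ ≡ n
⌊1+2*n/2⌋≡n n = trans (cong (λ k → ⌊ 1 + (n + k) /2⌋) (ℕ.+-identityʳ n)) (sym (ℕ.n≡⌈n+n/2⌉ n))

module Tripartite (a b c : ℕ) where

  -- At least two vertices per part ensure that the inner colour of each part occurs.
  size : Fin 3 → ℕ
  size 0F = 2 + a
  size 1F = 2 + b
  size 2F = 2 + c

  order : ℕ
  order = size 0F + size 1F + size 2F

  V : Set
  V = Fin order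

  at : ∀ i → Fin (size i) → V
  at 0F x = (x ↑ˡ size 1F) ↑ˡ size 2F
  at 1F x = (size 0F ↑ʳ x) ↑ˡ size 2F
  at 2F x = (size 0F + size 1F) ↑ʳ x

  part : V → Fin 3
  part v with splitAt (size 0F + size 1F) v
  ... | inj₂ _ = 2F
  ... | inj₁ w with splitAt (size 0F) w
  ... | inj₁ _ = 0F
  ... | inj₂ _ = 1F

  part-at : ∀ i x → part (at i x) ≡ i
  part-at 0F x rewrite Fin.splitAt-↑ˡ (size 0F + size 1F) (x ↑ˡ size 1F) (size 2F) | Fin.splitAt-↑ˡ (size 0F) x (size 1F) = refl
  part-at 1F x rewrite Fin.splitAt-↑ˡ (size 0F + size 1F) (size 0F ↑ʳ x) (size 2F) | Fin.splitAt-↑ʳ (size 0F) (size 1F) x = refl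
  part-at 2F x rewrite Fin.splitAt-↑ʳ (size 0F + size 1F) (size 2F) x = refl

  members : Fin 3 → List V
  members i = map (at i) (allFin (size i))

  length-members : ∀ i → length (members i) ≡ size i
  length-members i = trans (length-map (at i) (allFin (size i))) (length-tabulate _)

  ∈-members : ∀ v → v ∈ members (part v)
  ∈-members v with splitAt (size 0F + size 1F) v in eq
  ... | inj₂ x = subst (_∈ members 2F) (Fin.splitAt⁻¹-↑ʳ eq) (∈-map⁺ (at 2F) (∈-allFin x))
  ... | inj₁ w with splitAt (size 0F) w in eq′
  ... | inj₁ x = subst (_∈ members 0F)
    (trans (cong (_↑ˡ size 2F) (Fin.splitAt⁻¹-↑ˡ eq′)) (Fin.splitAt⁻¹-↑ˡ eq)) (∈-map⁺ (at 0F) (∈-allFin x))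
  ... | inj₂ x = subst (_∈ members 1F)
    (trans (cong (_↑ˡ size 2F) (Fin.splitAt⁻¹-↑ʳ eq′)) (Fin.splitAt⁻¹-↑ˡ eq)) (∈-map⁺ (at 1F) (∈-allFin x))

  part⇒∈ : ∀ v {i} → part v ≡ i → v ∈ members i
  part⇒∈ v refl = ∈-members v

  colour : V → V → Colour
  colour u v = hueOf (part u) (part v)

  colour-at : ∀ i j x y → colour (at i x) (at j y) ≡ hueOf i j
  colour-at i j x y = cong₂ hueOf (part-at i x) (part-at j y)

  inner : ∀ i → ∃₂ λ u v → u ≢ v × colour u v ≡ inject₁ i
  inner i = at i (first i) , at i (second i) , (λ eq → distinct i (at-injective i eq)) , trans (colour-at i i _ _) (hueOf-same i)
    where
    first second : ∀ i → Fin (size i)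
    first 0F = 0F
    first 1F = 0F
    first 2F = 0F
    second 0F = 1F
    second 1F = 1F
    second 2F = 1F
    distinct : ∀ i → first i ≢ second i
    distinct 0F ()
    distinct 1F ()
    distinct 2F ()
    at-injective : ∀ i {x y} → at i x ≡ at i y → x ≡ y
    at-injective 0F eq = Fin.↑ˡ-injective _ _ _ (Fin.↑ˡ-injective _ _ _ eq)
    at-injective 1F eq = Fin.↑ʳ-injective _ _ _ (Fin.↑ˡ-injective _ _ _ eq)
    at-injective 2F eq = Fin.↑ʳ-injective _ _ _ eq

  exact : ∀ c → ∃₂ λ u v → u ≢ v × colour u v ≡ c
  exact 0F = inner 0F
  exact 1F = inner 1F
  exact 2F = inner 2F
  exact 3F = at 0F 0F , at 1F 0F ,
    (λ eq → case trans (sym (part-at 0F 0F)) (trans (cong part eq) (part-at 1F 0F)) of λ ()) , colour-at 0F 1F 0F 0F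

  colouring : EdgeColouring 4 (K order)
  colouring = record { colour = colour ; colour-sym = λ u v → hueOf-sym (part u) (part v) ; exact = exact }

  no-rainbow : ¬ (∃[ f ] Rainbow {G = P 5} colouring f)
  no-rainbow (f , rainbow) = no-rainbow-hues (p 0F) (p 1F) (p 2F) (p 3F) (p 4F)
    ((distinct 0F 1F (λ ()) ∷ distinct 0F 2F (λ ()) ∷ distinct 0F 3F (λ ()) ∷ []) ∷
     (distinct 1F 2F (λ ()) ∷ distinct 1F 3F (λ ()) ∷ []) ∷
     (distinct 2F 3F (λ ()) ∷ []) ∷ [] ∷ [])
    where
    p : Fin 5 → Fin 3
    p i = part (Copy.embed f i)

    consecutive : ∀ i → Graph.Adj (P 5) (inject₁ i) (suc i)
    consecutive i = inj₁ (cong suc (sym (Fin.toℕ-inject₁ i)))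

    distinct : ∀ i j → i ≢ j → hueOf (p (inject₁ i)) (p (suc i)) ≢ hueOf (p (inject₁ j)) (p (suc j))
    distinct i j i≢j eq with rainbow (consecutive i) (consecutive j) eq
    ... | inj₁ (_ , si≡sj)   = i≢j (Fin.suc-injective si≡sj)
    -- A coincidence with reversed orientation would force both i = j + 1 and j = i + 1.
    ... | inj₂ (i≡sj , si≡j) = ℕ.<-asym
      (ℕ.≤-reflexive (trans (cong toℕ si≡j) (Fin.toℕ-inject₁ j)))
      (ℕ.≤-reflexive (trans (sym (cong toℕ i≡sj)) (Fin.toℕ-inject₁ i)))

  -- Two obstructions to a star in the crossing colour centred in part i: too few vertices in the
  -- other two parts, or fewer than r vertices in one of them, although every triangle needs a
  -- vertex there.
  Sparse : ℕ → ℕ → Fin 3 → Set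
  Sparse t r i = (∃₂ λ j k → j ≢ i × k ≢ i × j ≢ k × suc (size j + size k) < t) ⊎ (∃[ j ] j ≢ i × size j < r)

  -- A star in an inner colour stays in the part of its centre, which is too small. In the crossing
  -- colour all leaves avoid that part, and `Sparse` applies.
  no-star : ∀ {t r} → suc (2 * r) ≤ t → (∀ i → size i < t × Sparse t r i) → ¬ (∃[ f ] Monochromatic {G = S t r} colouring f)
  no-star {suc t} {r} r≤ sparse (f , c , mono) with c Fin.≟ 3F
  ... | no c≢3 = ℕ.<⇒≱ (proj₁ (sparse i)) (subst (suc t ≤_) (length-members i) (injective-∈⇒≤ (Copy.injective f) all-in))
    where
    i : Fin 3
    i = part (Copy.embed f zero)
    all-in : ∀ u → Copy.embed f u ∈ members i
    all-in zero    = ∈-members _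
    all-in (suc u) = part⇒∈ (Copy.embed f (suc u)) (sym (hueOf≢3⇒same i (part (Copy.embed f (suc u)))
      λ eq → c≢3 (trans (sym (mono (inj₁ (inj₁ (refl , s≤s z≤n))))) eq)))
  ... | yes refl = [ few , small ]′ (proj₂ (sparse (p zero)))
    where
    p : Fin (suc t) → Fin 3
    p u = part (Copy.embed f u)

    leaf : ∀ u → p (suc u) ≢ p zero
    leaf u eq = hueOf≡3⇒different (mono {zero} {suc u} (inj₁ (inj₁ (refl , s≤s z≤n)))) (sym eq)

    few : ¬ (∃₂ λ j k → j ≢ p zero × k ≢ p zero × j ≢ k × suc (size j + size k) < suc t)
    few (j , k , j≢ , k≢ , j≢k , j+k<) = ℕ.<⇒≱ (s≤s⁻¹ j+k<)
      (subst (t ≤_) (trans (length-++ (members j)) (cong₂ _+_ (length-members j) (length-members k)))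
        (injective-∈⇒≤ (λ eq → Fin.suc-injective (Copy.injective f eq)) leaf-in))
      where
      leaf-in : ∀ u → Copy.embed f (suc u) ∈ members j ++ members k
      leaf-in u with p (suc u) Fin.≟ j
      ... | yes u∈j = ∈-++⁺ˡ (part⇒∈ (Copy.embed f (suc u)) u∈j)
      ... | no u∉j  = ∈-++⁺ʳ (members j) (part⇒∈ (Copy.embed f (suc u)) (third (p zero) j k (p (suc u)) j≢ k≢ j≢k (leaf u) u∉j))

    small : ¬ (∃[ j ] j ≢ p zero × size j < r)
    small (j , j≢ , j<r) = ℕ.<⇒≱ j<r
      (subst (r ≤_) (length-members j) (injective-∈⇒≤ {f = λ m → Copy.embed f (end m)}
        (λ eq → end-injective (Copy.injective f eq)) end-in))
      where
      bound : ∀ (m : Fin r) → 2 + 2 * toℕ m ≤ t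
      bound m = ℕ.≤-trans (ℕ.≤-reflexive (sym (ℕ.*-suc 2 (toℕ m)))) (ℕ.≤-trans (ℕ.*-monoʳ-≤ 2 (Fin.toℕ<n m)) (s≤s⁻¹ r≤))

      -- The names refer to the labels 2m + 1 and 2m + 2 in `S`; as leaves counted from zero they
      -- have positions 2m and 2m + 1.
      odd even : Fin r → Fin t
      odd m  = fromℕ< (ℕ.<⇒≤ (bound m))
      even m = fromℕ< (bound m)

      odd-index : ∀ m → toℕ (odd m) ≡ 2 * toℕ m
      odd-index m = Fin.toℕ-fromℕ< _
      even-index : ∀ m → toℕ (even m) ≡ suc (2 * toℕ m)
      even-index m = Fin.toℕ-fromℕ< _

      parts-differ : ∀ m → p (suc (odd m)) ≢ p (suc (even m))
      parts-differ m = hueOf≡3⇒different (mono (inj₁ (inj₂ (m , cong suc (odd-index m) , cong suc (even-index m)))))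

      -- The ends of an added edge lie in different parts, neither of them that of the centre, so
      -- exactly one end lies in part j.
      chosen : Fin r → Fin t
      chosen m with p (suc (odd m)) Fin.≟ j
      ... | yes _ = odd m
      ... | no _  = even m

      end : Fin r → Fin (suc t)
      end m = suc (chosen m)

      end-in : ∀ m → Copy.embed f (end m) ∈ members j
      end-in m with p (suc (odd m)) Fin.≟ j
      ... | yes odd∈j = part⇒∈ (Copy.embed f (suc (odd m))) odd∈j
      ... | no odd∉j  = part⇒∈ (Copy.embed f (suc (even m)))
        (third (p zero) (p (suc (odd m))) j (p (suc (even m))) (leaf _) j≢ odd∉j (leaf _) (≢-sym (parts-differ m)))

      -- Both candidate positions, 2m and 2m + 1, halve to m. Hence the chosen ends are distinct
      -- whichever end is taken.
      half-chosen : ∀ m → ⌊ toℕ (chosen m) /2⌋ ≡ toℕ m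
      half-chosen m with p (suc (odd m)) Fin.≟ j
      ... | yes _ = trans (cong ⌊_/2⌋ (odd-index m)) (⌊2*n/2⌋≡n (toℕ m))
      ... | no _  = trans (cong ⌊_/2⌋ (even-index m)) (⌊1+2*n/2⌋≡n (toℕ m))

      end-injective : ∀ {m m′} → end m ≡ end m′ → m ≡ m′
      end-injective {m} {m′} eq = Fin.toℕ-injective
        (trans (sym (half-chosen m)) (trans (cong (⌊_/2⌋ ∘ toℕ) (Fin.suc-injective eq)) (half-chosen m′)))

-- The upper bound

module _ {A : Set} where

  AllPairs-resp-↭ : ∀ {R : (A → A → Set)} → Symmetric R → ∀ {xs ys} → xs ↭ ys → AllPairs R xs → AllPairs R ys
  AllPairs-resp-↭ {R} R-sym p =
    SetoidPermutation.AllPairs-resp-↭ (setoid A) R-sym ((λ { refl r → r }) , (λ { refl r → r })) (↭⇒↭ₛ p)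

  AllPairs-++⁻ : ∀ {R : A → A → Set} xs {ys} → AllPairs R (xs ++ ys) →
                 AllPairs R xs × All (λ x → All (R x) ys) xs × AllPairs R ys
  AllPairs-++⁻ []       rs       = [] , [] , rs
  AllPairs-++⁻ (x ∷ xs) (r ∷ rs) with AllPairs-++⁻ xs rs
  ... | rs₁ , rs₂ , rs₃ = All.++⁻ˡ xs r ∷ rs₁ , All.++⁻ʳ xs r ∷ rs₂ , rs₃

  tabulatePairs : ∀ {P : A → Set} {R : (A → A → Set)} → (∀ {u v} → u ≢ v → P u → P v → R u v) →
                  ∀ {xs} → All P xs → Unique xs → AllPairs R xs
  tabulatePairs f []         []         = []
  tabulatePairs f (px ∷ pxs) (x∉ ∷ xs!) =
    All.zipWith (λ (x≢y , py) → f x≢y px py) (x∉ , pxs) ∷ tabulatePairs f pxs xs!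

  flatten-++ : ∀ (ps : List (A × A)) {qs} → flatten (ps ++ qs) ≡ flatten ps ++ flatten qs
  flatten-++ []       = refl
  flatten-++ (_ ∷ ps) = cong (λ xs → _ ∷ _ ∷ xs) (flatten-++ ps)

  length-flatten : ∀ (ps : List (A × A)) → length (flatten ps) ≡ 2 * length ps
  length-flatten []       = refl
  length-flatten (_ ∷ ps) = trans (cong (2 +_) (length-flatten ps)) (sym (ℕ.*-suc 2 (length ps)))

  module _ {P Q : A → A → Set} where

    findAmong : ∀ {x} xs → All (λ y → P x y ⊎ Q x y) xs →
                (∃₂ λ y rest → xs ↭ y ∷ rest × P x y) ⊎ All (Q x) xs
    findAmong []       []              = inj₂ []
    findAmong (y ∷ ys) (inj₁ p ∷ _)    = inj₁ (y , ys , ↭-refl , p)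
    findAmong (y ∷ ys) (inj₂ q ∷ pqs) with findAmong ys pqs
    ... | inj₁ (z , rest , perm , p) = inj₁ (z , y ∷ rest , ↭-trans (↭-prep y perm) (↭-swap y z ↭-refl) , p)
    ... | inj₂ qs                    = inj₂ (q ∷ qs)

    findPair : ∀ xs → AllPairs (λ x y → P x y ⊎ Q x y) xs →
               (∃₂ λ x y → ∃[ rest ] xs ↭ x ∷ y ∷ rest × P x y) ⊎ AllPairs Q xs
    findPair []       []           = inj₂ []
    findPair (x ∷ xs) (x-xs ∷ pqs) with findAmong xs x-xs
    ... | inj₁ (y , rest , perm , p) = inj₁ (x , y , rest , ↭-prep x perm , p)
    ... | inj₂ x-qs with findPair xs pqs
    ... | inj₂ qs = inj₂ (x-qs ∷ qs)
    ... | inj₁ (y , z , rest , perm , p) = inj₁ (y , z , x ∷ rest ,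
      ↭-trans (↭-prep x perm) (↭-trans (↭-swap x y ↭-refl) (↭-prep y (↭-swap x z ↭-refl))) , p)

    -- Pairs in P are removed one at a time; when none is left, all remaining pairs are in Q.
    greedyMatching : Symmetric P → Symmetric Q → ∀ k xs → AllPairs (λ x y → P x y ⊎ Q x y) xs →
      ∃₂ λ ps rest → xs ↭ flatten ps ++ rest × All (λ (x , y) → P x y) ps ×
      (length ps ≡ k ⊎ length ps < k × AllPairs Q rest)
    greedyMatching P-sym Q-sym zero    xs pqs = [] , xs , ↭-refl , [] , inj₁ refl
    greedyMatching P-sym Q-sym (suc k) xs pqs with findPair xs pqs
    ... | inj₂ qs = [] , xs , ↭-refl , [] , inj₂ (s≤s z≤n , qs)
    ... | inj₁ (x , y , ys , perm , p) with AllPairs-resp-↭ (λ { (inj₁ p) → inj₁ (P-sym p) ; (inj₂ q) → inj₂ (Q-sym q) }) perm pqs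
    ... | _ ∷ _ ∷ pqs′ with greedyMatching P-sym Q-sym k ys pqs′
    ... | ps , rest , perm′ , ps-P , outcome =
      (x , y) ∷ ps , rest , ↭-trans perm (↭-prep x (↭-prep y perm′)) , p ∷ ps-P ,
      [ (λ eq → inj₁ (cong suc eq)) , (λ (lt , qs) → inj₂ (s≤s lt , qs)) ]′ outcome

  zipPairs : ∀ k (xs ys : List A) → k ≤ length xs → k ≤ length ys →
             ∃₂ λ ps rest → length ps ≡ k × xs ++ ys ↭ flatten ps ++ rest × All (λ (x , y) → x ∈ xs × y ∈ ys) ps
  zipPairs zero    xs       ys       _        _        = [] , xs ++ ys , refl , ↭-refl , []
  zipPairs (suc k) (x ∷ xs) (y ∷ ys) (s≤s le) (s≤s le′) with zipPairs k xs ys le le′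
  ... | ps , rest , len , perm , ps∈ = (x , y) ∷ ps , rest , cong suc len ,
    ↭-prep x (↭-trans (shift y xs ys) (↭-prep y perm)) ,
    (here refl , here refl) ∷ All.map (λ (x∈ , y∈) → there x∈ , there y∈) ps∈

-- Counting with the sizes of the three classes

-- The two larger classes must supply the t - 1 = 2m leaves. Otherwise 3(a + b + 1) ≤ 6m ≤ 2(n + 1),
-- whereas 2(a + b + c) ≤ 3(a + b).
a+b≥2m : ∀ {a b c n m} → b ≤ a → c ≤ b → n ≤ a + b + c → 3 * m ≤ suc n → 2 * m ≤ a + b
a+b≥2m {a} {b} {c} {n} {m} b≤a c≤b n≤ m≤ = ℕ.≮⇒≥ λ lt → ℕ.<-irrefl refl (begin-strict
  2 * (3 * m)             ≤⟨ ℕ.*-monoʳ-≤ 2 m≤ ⟩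
  2 * suc n               ≤⟨ ℕ.*-monoʳ-≤ 2 (s≤s n≤) ⟩
  2 * suc (a + b + c)     ≡⟨ lhs a b c ⟩
  2 + (2 * (a + b) + (c + c)) ≤⟨ ℕ.+-monoʳ-≤ 2 (ℕ.+-monoʳ-≤ (2 * (a + b)) (ℕ.+-mono-≤ (ℕ.≤-trans c≤b b≤a) c≤b)) ⟩
  2 + (2 * (a + b) + (a + b)) <⟨ ℕ.≤-refl ⟩
  3 + (2 * (a + b) + (a + b)) ≡⟨ rhs (a + b) ⟩
  3 * suc (a + b)         ≤⟨ ℕ.*-monoʳ-≤ 3 lt ⟩
  3 * (2 * m)             ≡⟨ swap m ⟩
  2 * (3 * m)             ∎)
  where
  open ℕ.≤-Reasoning
  lhs : ∀ (a b c : ℕ) → 2 * suc (a + b + c) ≡ 2 + (2 * (a + b) + (c + c))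
  lhs = solve-∀
  rhs : ∀ (s : ℕ) → 3 + (2 * s + s) ≡ 3 * suc s
  rhs = solve-∀
  swap : ∀ (m : ℕ) → 3 * (2 * m) ≡ 2 * (3 * m)
  swap = solve-∀

-- A matching stuck at p pairs has p + b < r. Since 2m + 2r ≤ n + 1 ≤ 2p + rest + 2b + 1, at least t
-- = 2m + 1 vertices remain unmatched.
room-for-clique : ∀ {a b c n m r p rest} → c ≤ b → n ≤ a + b + c → 2 * m + 2 * r ≤ suc n →
                  suc p + b ≤ r → a ≡ 2 * p + rest → suc (2 * m) ≤ rest
room-for-clique {a} {b} {c} {n} {m} {r} {p} {rest} c≤b n≤ mr≤ pb≤ refl =
  ℕ.+-cancelˡ-≤ (2 * (p + b) + 1) _ _ (begin
    (2 * (p + b) + 1) + suc (2 * m) ≡⟨ lhs m p b ⟩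
    2 * m + 2 * (suc p + b)         ≤⟨ ℕ.+-monoʳ-≤ (2 * m) (ℕ.*-monoʳ-≤ 2 pb≤) ⟩
    2 * m + 2 * r                   ≤⟨ mr≤ ⟩
    suc n                           ≤⟨ s≤s n≤ ⟩
    suc (2 * p + rest + b + c)      ≤⟨ s≤s (ℕ.+-monoʳ-≤ (2 * p + rest + b) c≤b) ⟩
    suc (2 * p + rest + b + b)      ≡⟨ rhs p rest b ⟩
    (2 * (p + b) + 1) + rest        ∎)
  where
  open ℕ.≤-Reasoning
  lhs : ∀ (m p b : ℕ) → (2 * (p + b) + 1) + suc (2 * m) ≡ 2 * m + 2 * (suc p + b)
  lhs = solve-∀
  rhs : ∀ (p rest b : ℕ) → suc (2 * p + rest + b + b) ≡ (2 * (p + b) + 1) + rest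
  rhs = solve-∀

-- With k = r ∸ b petals inside the part of size a, the other r ∸ k ones each need one more of its vertices.
room-for-flower : ∀ {a b c n m r} → b ≤ a → c ≤ b → n ≤ a + b + c → 2 * m + 2 * r ≤ suc n → r < m →
                  (r ∸ b) + r ≤ a
room-for-flower {a} {b} {c} {n} {m} {r} b≤a c≤b n≤ mr≤ r<m with ℕ.≤-total r b
... | inj₁ r≤b rewrite ℕ.m≤n⇒m∸n≡0 r≤b = ℕ.≤-trans r≤b b≤a
... | inj₂ b≤r = ℕ.+-cancelʳ-≤ (b + suc b) _ _ (begin
    (r ∸ b) + r + (b + suc b) ≡⟨ lhs (r ∸ b) r b ⟩
    ((r ∸ b) + b) + (r + suc b) ≡⟨ cong (_+ (r + suc b)) (ℕ.m∸n+n≡m b≤r) ⟩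
    r + (r + suc b)           ≤⟨ ℕ.+-monoʳ-≤ r (ℕ.+-monoʳ-≤ r (ℕ.≤-trans (s≤s b≤r) (ℕ.≤-trans r<m (ℕ.m≤m+n m (m + 0))))) ⟩
    r + (r + 2 * m)           ≡⟨ mid r m ⟩
    2 * m + 2 * r             ≤⟨ mr≤ ⟩
    suc n                     ≤⟨ s≤s n≤ ⟩
    suc (a + b + c)           ≤⟨ s≤s (ℕ.+-monoʳ-≤ (a + b) c≤b) ⟩
    suc (a + b + b)           ≡⟨ rhs a b ⟩
    a + (b + suc b)           ∎)
  where
  open ℕ.≤-Reasoning
  lhs : ∀ (k r b : ℕ) → k + r + (b + suc b) ≡ (k + b) + (r + suc b)
  lhs = solve-∀
  mid : ∀ (r m : ℕ) → r + (r + 2 * m) ≡ 2 * m + 2 * r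
  mid = solve-∀
  rhs : ∀ (a b : ℕ) → suc (a + b + b) ≡ a + (b + suc b)
  rhs = solve-∀

-- Monochromatic stars in the two structures

module _ {n : ℕ} (Χ : EdgeColouring 4 (K n)) {r m : ℕ} (r<m : r < m) where

  open EdgeColouring Χ renaming (colour to χ; colour-sym to χ-sym) hiding (exact)

  private
    V : Set
    V = Fin n

    t : ℕ
    t = suc (2 * m)

    r-fits : suc (2 * r) ≤ t
    r-fits = s≤s (ℕ.*-monoʳ-≤ 2 (ℕ.<⇒≤ r<m))

  Has : Colour → V → V → Set
  Has c u v = χ u v ≡ c

  Has-sym : ∀ {c} → Symmetric (Has c)
  Has-sym {c} {u} {v} uv = trans (χ-sym v u) uv

  nearlyMonochromatic⇒star : NearlyMonochromatic χ χ-sym → t + 4 ≤ n → MonochromaticStar Χ t r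
  nearlyMonochromatic⇒star (vs@(v ∷ _) , |vs| , vs! , c , mono) t+4≤n
    -- All entries equal the vertex v of vs, so `cover` returns t vertices outside vs.
    with us , |us| , all! , _ ← cover (replicate t v) vs! (subst₂ (λ j k → j + k ≤ n) (sym (length-replicate t)) (sym |vs|) t+4≤n) =
    clique Χ us! (tabulatePairs (λ p≢q p∉ q∉ → mono _ _ p≢q p∉ q∉) us∉ us!) r-fits
      (ℕ.≤-reflexive (sym (trans |us| (length-replicate t))))
    where
    us! : Unique us
    us! = proj₁ (AllPairs-++⁻ us all!)
    us∉ : All (_∉ vs) us
    us∉ = All.map All.All¬⇒¬Any (proj₁ (proj₂ (AllPairs-++⁻ us all!)))

  module _ {x : V} {c₀ d : Colour} {A B : List V} (all! : Unique (x ∷ A ++ B))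
           (x-spokes : All (Has c₀ x) (A ++ B)) (A-B : ∀ {u v} → u ∈ A → v ∈ B → Has c₀ u v)
           (A-inside : AllPairs (λ u v → Has c₀ u v ⊎ Has d u v) A)
           {c : ℕ} (B≤A : length B ≤ length A) (c≤B : c ≤ length B) (n≤ : n ≤ length A + length B + c)
           (3m≤ : 3 * m ≤ suc n) (mr≤ : 2 * m + 2 * r ≤ suc n) where

    split-length : ∀ (ps : List (V × V)) {rest} → A ↭ flatten ps ++ rest → length A ≡ 2 * length ps + length rest
    split-length ps {rest} perm =
      trans (↭-length perm) (trans (length-++ (flatten ps)) (cong (_+ length rest) (length-flatten ps)))

    regroup : ∀ (p q : ℕ) → 2 * p + q ≡ p + (p + q)
    regroup = solve-∀

    star-in-parts : MonochromaticStar Χ t r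
    -- At most |B| disjoint petals can join A to B, so the other `r ∸ length B` are sought inside A.
    star-in-parts with greedyMatching (Has-sym {c₀}) (Has-sym {d}) (r ∸ length B) A A-inside
    ... | ps , rest , perm , ps-c₀ , inj₂ (few , mono) =
      clique Χ (proj₂ (proj₂ (AllPairs-++⁻ (flatten ps) (AllPairs-resp-↭ ≢-sym perm A!)))) mono r-fits
        (room-for-clique {length A} {m = m} {r} {length ps} c≤B n≤ mr≤
          -- Having fewer than `r ∸ length B` pairs shows that this difference is positive, hence
          -- not truncated.
          (ℕ.m≤o∸n⇒m+n≤o _ (ℕ.<⇒≤ (ℕ.m∸n≢0⇒n<m λ eq → ℕ.n≮0 (subst (length ps <_) eq few))) few)
          (split-length ps perm))
      where
      A! : Unique A
      A! = proj₁ (AllPairs-++⁻ A (AllPairs.tail all!))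
    -- The missing petals join vertices of B to unmatched vertices of A; everything left over
    -- becomes available for pendent edges.
    ... | ps , rest , perm , ps-c₀ , inj₁ |ps|≡ with zipPairs (r ∸ length ps) B rest enough-B enough-rest
      where
      enough-B : r ∸ length ps ≤ length B
      enough-B = ℕ.m≤n+o⇒m∸n≤o r (length ps)
        (subst₂ _≤_ refl (trans (ℕ.+-comm (length B) _) (cong (_+ length B) (sym |ps|≡))) (ℕ.m≤n+m∸n r (length B)))
      enough-rest : r ∸ length ps ≤ length rest
      enough-rest = ℕ.m≤n+o⇒m∸n≤o r (length ps) (ℕ.+-cancelˡ-≤ (length ps) _ _
        (subst₂ _≤_ (cong (_+ r) (sym |ps|≡)) (trans (split-length ps perm) (regroup (length ps) (length rest)))
          (room-for-flower {length A} B≤A c≤B n≤ mr≤ r<m)))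
    ... | qs , left , |qs|≡ , perm′ , qs∈ = flower Χ {ps = ps ++ qs} {rest = left}
      (AllPairs-resp-↭ ≢-sym (↭-prep x whole) all!)
      (trans (length-++ ps) (trans (cong (length ps +_) |qs|≡) (ℕ.m+[n∸m]≡n |ps|≤r)))
      (s≤s (ℕ.≤-trans (a+b≥2m {length A} {length B} {m = m} B≤A c≤B n≤ 3m≤)
        (ℕ.≤-reflexive (trans (sym (length-++ A)) (↭-length whole)))))
      (All-resp-↭ whole x-spokes)
      (All.++⁺ ps-c₀
        (All.map (λ (u∈B , v∈rest) → Has-sym (A-B (∈-resp-↭ (↭-sym perm) (∈-++⁺ʳ (flatten ps) v∈rest)) u∈B)) qs∈))
      where
      |ps|≤r : length ps ≤ r
      |ps|≤r = subst (_≤ r) (sym |ps|≡) (ℕ.m∸n≤m r (length B))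
      whole : A ++ B ↭ flatten (ps ++ qs) ++ left
      whole = begin
        A ++ B                              ↭⟨ ++⁺ʳ B perm ⟩
        (flatten ps ++ rest) ++ B           ≡⟨ ++-assoc (flatten ps) rest B ⟩
        flatten ps ++ (rest ++ B)           ↭⟨ ++⁺ˡ (flatten ps) (++-comm rest B) ⟩
        flatten ps ++ (B ++ rest)           ↭⟨ ++⁺ˡ (flatten ps) perm′ ⟩
        flatten ps ++ (flatten qs ++ left)  ≡⟨ sym (++-assoc (flatten ps) (flatten qs) left) ⟩
        (flatten ps ++ flatten qs) ++ left  ≡⟨ cong (_++ left) (sym (flatten-++ ps)) ⟩
        flatten (ps ++ qs) ++ left          ∎
        where open PermutationReasoning

  module _ {c₀ : Colour} (dominates : ∀ v p q → v ≢ p → v ≢ q → χ v p ≢ c₀ → χ v q ≢ c₀ → χ v p ≡ χ v q)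
           {default : Colour} (default≢ : default ≢ c₀) where

    other? : ∀ v → Dec (∃[ p ] v ≢ p × χ v p ≢ c₀)
    other? v = Fin.any? λ p → ¬? (v Fin.≟ p) ×-dec ¬? (χ v p Fin.≟ c₀)

    -- By domination the choice of p does not affect the colour. A vertex that meets only `c₀` fits
    -- into any class and gets `default`.
    part : V → Colour
    part v with other? v
    ... | yes (p , _) = χ v p
    ... | no _        = default

    part≢c₀ : ∀ v → part v ≢ c₀
    part≢c₀ v with other? v
    ... | yes (_ , _ , vp≢c₀) = vp≢c₀
    ... | no _                = default≢

    part≡ : ∀ {u v} → u ≢ v → χ u v ≢ c₀ → part u ≡ χ u v
    part≡ {u} {v} u≢v uv≢c₀ with other? u
    ... | yes (p , u≢p , up≢c₀) = dominates u p v u≢p u≢v up≢c₀ uv≢c₀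
    ... | no none               = contradiction (v , u≢v , uv≢c₀) none

    inside : ∀ {u v} → u ≢ v → Has c₀ u v ⊎ Has (part u) u v
    inside {u} {v} u≢v with χ u v Fin.≟ c₀
    ... | yes uv≡c₀ = inj₁ uv≡c₀
    ... | no uv≢c₀  = inj₂ (sym (part≡ u≢v uv≢c₀))

    -- An edge of any other colour would be the colour of the class of both its ends.
    across : ∀ {u v} → part u ≢ part v → Has c₀ u v
    across {u} {v} differ with χ u v Fin.≟ c₀
    ... | yes uv≡c₀ = uv≡c₀
    ... | no uv≢c₀  = contradiction
      (trans (part≡ u≢v uv≢c₀) (trans (χ-sym u v) (sym (part≡ (≢-sym u≢v) λ eq → uv≢c₀ (trans (χ-sym u v) eq))))) differ
      where
      u≢v : u ≢ v
      u≢v u≡v = differ (cong part u≡v)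

    class : Colour → List V
    class d = filter (λ v → part v Fin.≟ d) (allFin n)

    ∈-class⁺ : ∀ {v d} → part v ≡ d → v ∈ class d
    ∈-class⁺ {v} {d} v∈ = ∈-filter⁺ (λ v → part v Fin.≟ d) (∈-allFin v) v∈

    ∈-class⁻ : ∀ {v} d → v ∈ class d → part v ≡ d
    ∈-class⁻ d v∈ = proj₂ (∈-filter⁻ (λ v → part v Fin.≟ d) {xs = allFin n} v∈)

    class! : ∀ d → Unique (class d)
    class! d = Unique.filter⁺ (λ v → part v Fin.≟ d) (Unique.allFin⁺ n)

    across-classes : ∀ {d e u v} → d ≢ e → u ∈ class d → v ∈ class e → u ≢ v × Has c₀ u v
    across-classes {d} {e} d≢e u∈ v∈ = (λ u≡v → differ (cong part u≡v)) , across differ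
      where
      differ : part _ ≢ part _
      differ eq = d≢e (trans (sym (∈-class⁻ d u∈)) (trans eq (∈-class⁻ e v∈)))

    module _ (exact : Exact χ χ-sym) (3m≤ : 3 * m ≤ suc n) (mr≤ : 2 * m + 2 * r ≤ suc n) where

      sorted : ∀ d e f → Unique (d ∷ e ∷ f ∷ c₀ ∷ []) → length (class e) ≤ length (class d) →
               length (class f) ≤ length (class e) → MonochromaticStar Χ t r
      sorted d e f palette!@((d≢e ∷ d≢f ∷ _) ∷ (e≢f ∷ _) ∷ (f≢c₀ ∷ []) ∷ _) e≤d f≤e
        -- Exactness makes the smallest class nonempty: an end x of an edge of colour f lies in it
        -- and becomes the centre.
        with x , y , x≢y , xy ← exact f =
        star-in-parts {d = d} {A = class d} {B = class e}
          (All.tabulate (proj₁ ∘ spoke) ∷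
            Unique.++⁺ (class! d) (class! e) λ (u∈ , u∈′) → proj₁ (across-classes d≢e u∈ u∈′) refl)
          (All.tabulate (proj₂ ∘ spoke))
          (λ u∈ v∈ → proj₂ (across-classes d≢e u∈ v∈))
          (tabulatePairs (λ u≢v u∈ _ → subst (λ d → Has c₀ _ _ ⊎ Has d _ _) u∈ (inside u≢v))
            (All.tabulate (∈-class⁻ d)) (class! d))
          e≤d f≤e n≤ 3m≤ mr≤
        where
        x∈ : x ∈ class f
        x∈ = ∈-class⁺ (trans (part≡ x≢y (λ eq → f≢c₀ (trans (sym xy) eq))) xy)

        spoke : ∀ {v} → v ∈ class d ++ class e → x ≢ v × Has c₀ x v
        spoke v∈ = [ across-classes (≢-sym d≢f) x∈ , across-classes (≢-sym e≢f) x∈ ]′ (∈-++⁻ (class d) v∈)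

        all-in : ∀ v → v ∈ (class d ++ class e) ++ class f
        all-in v with injective⇒surjective (lookup-injective palette!) (part v)
        ... | 0F , eq = ∈-++⁺ˡ (∈-++⁺ˡ (∈-class⁺ (sym eq)))
        ... | 1F , eq = ∈-++⁺ˡ (∈-++⁺ʳ (class d) (∈-class⁺ (sym eq)))
        ... | 2F , eq = ∈-++⁺ʳ (class d ++ class e) (∈-class⁺ (sym eq))
        ... | 3F , eq = contradiction (sym eq) (part≢c₀ v)

        n≤ : n ≤ length (class d) + length (class e) + length (class f)
        n≤ = subst (n ≤_)
          (trans (length-++ (class d ++ class e)) (cong (_+ length (class f)) (length-++ (class d))))
          (injective-∈⇒≤ (λ eq → eq) all-in)

      unsorted : ∀ {d e f} → Unique (d ∷ e ∷ f ∷ c₀ ∷ []) → MonochromaticStar Χ t r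
      unsorted {d} {e} {f} ((d≢e ∷ d≢f ∷ d≢c ∷ []) ∷ (e≢f ∷ e≢c ∷ []) ∷ (f≢c ∷ []) ∷ _)
        with ℕ.≤-total (length (class d)) (length (class e)) | ℕ.≤-total (length (class d)) (length (class f))
           | ℕ.≤-total (length (class e)) (length (class f))
      ... | inj₂ e≤d | _        | inj₂ f≤e = sorted d e f
        ((d≢e ∷ d≢f ∷ d≢c ∷ []) ∷ (e≢f ∷ e≢c ∷ []) ∷ (f≢c ∷ []) ∷ [] ∷ [])
        e≤d f≤e
      ... | _        | inj₂ f≤d | inj₁ e≤f = sorted d f e
        ((d≢f ∷ d≢e ∷ d≢c ∷ []) ∷ (≢-sym e≢f ∷ f≢c ∷ []) ∷ (e≢c ∷ []) ∷ [] ∷ [])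
        f≤d e≤f
      ... | inj₁ d≤e | inj₂ f≤d | inj₂ _   = sorted e d f
        ((≢-sym d≢e ∷ e≢f ∷ e≢c ∷ []) ∷ (d≢f ∷ d≢c ∷ []) ∷ (f≢c ∷ []) ∷ [] ∷ [])
        d≤e f≤d
      ... | _        | inj₁ d≤f | inj₂ f≤e = sorted e f d
        ((e≢f ∷ ≢-sym d≢e ∷ e≢c ∷ []) ∷ (≢-sym d≢f ∷ f≢c ∷ []) ∷ (d≢c ∷ []) ∷ [] ∷ [])
        f≤e d≤f
      ... | inj₂ e≤d | inj₁ d≤f | inj₁ _   = sorted f d e
        ((≢-sym d≢f ∷ ≢-sym e≢f ∷ f≢c ∷ []) ∷ (d≢e ∷ d≢c ∷ []) ∷ (e≢c ∷ []) ∷ [] ∷ [])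
        d≤f e≤d
      ... | inj₁ d≤e | _        | inj₁ e≤f = sorted f e d
        ((≢-sym e≢f ∷ ≢-sym d≢f ∷ f≢c ∷ []) ∷ (≢-sym d≢e ∷ e≢c ∷ []) ∷ (d≢c ∷ []) ∷ [] ∷ [])
        e≤f d≤e

  dominated⇒star : Exact χ χ-sym → Dominated χ χ-sym → 3 * m ≤ suc n → 2 * m + 2 * r ≤ suc n → MonochromaticStar Χ t r
  dominated⇒star exact (c₀ , dominates) 3m≤ mr≤ with palette₁ c₀
  ... | d , e , f , palette!@((_ ∷ _ ∷ d≢c₀ ∷ []) ∷ _) = unsorted dominates d≢c₀ exact 3m≤ mr≤ palette!

  rainbow-or-star : 3 ≤ r → 3 * m ≤ suc n → 2 * m + 2 * r ≤ suc n →
                    (∃[ f ] Rainbow {G = P 5} Χ f) ⊎ MonochromaticStar Χ t r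
  rainbow-or-star 3≤r 3m≤ mr≤ with rainbowPath₄? Χ
  ... | yes rainbow   = inj₁ (rainbowPath⇒copy Χ rainbow)
  ... | no no-rainbow = inj₂ ([ (λ near → nearlyMonochromatic⇒star near t+4≤n)
                              , (λ dominated → dominated⇒star (EdgeColouring.exact Χ) dominated 3m≤ mr≤)
                              ]′ (structure χ χ-sym no-rainbow 6≤n (EdgeColouring.exact Χ)))
    where
    -- Here r ≥ 3 enters: t + 5 = 2m + 6 ≤ 2m + 2r ≤ n + 1.
    t+5≤1+n : t + 5 ≤ suc n
    t+5≤1+n = ℕ.≤-trans (ℕ.≤-reflexive (shuffle m)) (ℕ.≤-trans (ℕ.+-monoʳ-≤ (2 * m) (ℕ.*-monoʳ-≤ 2 3≤r)) mr≤)
      where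
      shuffle : ∀ (m : ℕ) → suc (2 * m) + 5 ≡ 2 * m + 2 * 3
      shuffle = solve-∀
    t+4≤n : t + 4 ≤ n
    t+4≤n = s≤s⁻¹ (ℕ.≤-trans (ℕ.≤-reflexive (sym (ℕ.+-suc t 4))) t+5≤1+n)
    6≤n : 6 ≤ n
    6≤n = ℕ.≤-trans (ℕ.+-monoˡ-≤ 4 (s≤s (ℕ.≤-trans (ℕ.≤-trans (s≤s z≤n) r<m) (ℕ.m≤m+n m (m + 0))))) t+4≤n

-- The values of the Gallai-Ramsey numbers

n≤[1+n]C2 : ∀ n → n ≤ suc n C 2
n≤[1+n]C2 n = subst (n ≤_) (nCk+nC[k+1]≡[n+1]C[k+1] n 1)
  (ℕ.≤-trans (ℕ.≤-reflexive (sym (nC1≡n n))) (ℕ.m≤m+n (n C 1) (n C 2)))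

-- The two inequalities on N give the upper bound and pass to every larger n; the tripartite
-- colouring on N - 1 vertices refutes every smaller bound.
gallaiRamsey : ∀ {r m N} a b c → let open Tripartite a b c in
  3 ≤ r → r < m → 3 * m ≤ suc N → 2 * m + 2 * r ≤ suc N → N ≡ suc order →
  (∀ i → size i < suc (2 * m) × Sparse (suc (2 * m)) r i) →
  gr 4 ⟨ P 5 ∶ S (suc (2 * m)) r ⟩≡ N
gallaiRamsey {r} {m} a b c 3≤r r<m 3m≤ mr≤ refl sparse =
  -- From 6 ≤ 2m + 2r ≤ N + 1 follows 4 ≤ N - 1, which is at most the number of edges of `K N`.
  (ℕ.≤-trans (s≤s⁻¹ (s≤s⁻¹ (ℕ.≤-trans 6≤mr mr≤))) (n≤[1+n]C2 order) , bound) ,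
  λ M (_ , bound-M) → ℕ.≮⇒≥ λ M<N →
    [ no-rainbow , no-star (s≤s (ℕ.*-monoʳ-≤ 2 (ℕ.<⇒≤ r<m))) sparse ]′ (bound-M order (s≤s⁻¹ M<N) colouring)
  where
  open Tripartite a b c
  6≤mr : 6 ≤ 2 * m + 2 * r
  6≤mr = ℕ.≤-trans (ℕ.*-monoʳ-≤ 2 3≤r) (ℕ.m≤n+m (2 * r) (2 * m))
  bound : ∀ n → suc order ≤ n → _
  bound n N≤n Χ = rainbow-or-star Χ r<m 3≤r (ℕ.≤-trans 3m≤ (s≤s N≤n)) (ℕ.≤-trans mr≤ (s≤s N≤n))

-- Here N = 3m - 1, and the extremal parts have sizes m - 1, m - 1, m. Any two of them have at most
-- 2m - 1 vertices, too few for the leaves.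
few-triangles : ∀ r m → 3 ≤ r → 2 * r ≤ m → gr 4 ⟨ P 5 ∶ S (suc (2 * m)) r ⟩≡ ((3 * suc (2 * m) ∸ 5) / 2)
few-triangles r m 3≤r 2r≤m with m ∸ 3 | ℕ.m+[n∸m]≡n (ℕ.≤-trans 3≤r (ℕ.≤-trans (ℕ.m≤m+n r (r + 0)) 2r≤m))
... | k | refl = gallaiRamsey k k (suc k) 3≤r r<m
  (subst (λ N → 3 * m ≤ suc N) (sym N≡) (ℕ.≤-reflexive (3m≡ k)))
  (subst (λ N → 2 * m + 2 * r ≤ suc N) (sym N≡)
    (ℕ.≤-trans (ℕ.+-monoʳ-≤ (2 * m) 2r≤m) (ℕ.≤-reflexive (trans (2m+m≡3m m) (3m≡ k)))))
  N≡
  λ { 0F → s≤s (ℕ.≤-trans (ℕ.n≤1+n _) (ℕ.m≤m+n m _)) , inj₁ (1F , 2F , (λ ()) , (λ ()) , (λ ()) , ℕ.≤-reflexive (large k))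
    ; 1F → s≤s (ℕ.≤-trans (ℕ.n≤1+n _) (ℕ.m≤m+n m _)) , inj₁ (0F , 2F , (λ ()) , (λ ()) , (λ ()) , ℕ.≤-reflexive (large k))
    ; 2F → s≤s (ℕ.m≤m+n m _) , inj₁ (0F , 1F , (λ ()) , (λ ()) , (λ ()) ,
      ℕ.≤-trans (ℕ.n≤1+n _) (ℕ.≤-reflexive (large′ k))) }
  where
  r<m : r < m
  r<m = ℕ.<-≤-trans (ℕ.m<m+n r (ℕ.≤-trans (ℕ.≤-trans (s≤s z≤n) 3≤r) (ℕ.m≤m+n r 0))) 2r≤m

  order≡ : ∀ (k : ℕ) → 3 * suc (2 * (3 + k)) ≡ 5 + (8 + 3 * k) * 2
  order≡ = solve-∀
  shape : ∀ (k : ℕ) → 8 + 3 * k ≡ suc ((2 + k) + (2 + k) + (3 + k))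
  shape = solve-∀
  3m≡ : ∀ (k : ℕ) → 3 * (3 + k) ≡ suc (suc ((2 + k) + (2 + k) + (3 + k)))
  3m≡ = solve-∀
  2m+m≡3m : ∀ (m : ℕ) → 2 * m + m ≡ 3 * m
  2m+m≡3m = solve-∀
  large : ∀ (k : ℕ) → 2 + ((2 + k) + (3 + k)) ≡ 1 + 2 * (3 + k)
  large = solve-∀
  large′ : ∀ (k : ℕ) → 3 + ((2 + k) + (2 + k)) ≡ 1 + 2 * (3 + k)
  large′ = solve-∀

  N≡ : (3 * suc (2 * m) ∸ 5) / 2 ≡ suc ((2 + k) + (2 + k) + (3 + k))
  N≡ = trans (cong (λ x → (x ∸ 5) / 2) (order≡ k)) (trans (m*n/n≡m (8 + 3 * k) 2) (shape k))

-- Here N = 2m + 2r - 1, and the extremal parts have sizes 2m, r - 1, r - 1. A centre in the large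
-- part has too few leaves; a centre in a small part leaves only r - 1 vertices in the other small
-- part for r triangles.
many-triangles : ∀ r m → 3 ≤ r → r < m → m ≤ 2 * r → gr 4 ⟨ P 5 ∶ S (suc (2 * m)) r ⟩≡ (suc (2 * m) + 2 * r ∸ 2)
many-triangles r m@(suc q) 3≤r r<m m≤2r with r ∸ 3 | ℕ.m+[n∸m]≡n 3≤r
... | j | refl = gallaiRamsey (2 * q) j j 3≤r r<m
  (subst (λ N → 3 * m ≤ suc N) (sym N≡)
    (ℕ.≤-trans (ℕ.≤-reflexive (sym (2m+m≡3m m))) (ℕ.≤-trans (ℕ.+-monoʳ-≤ (2 * m) m≤2r) (ℕ.≤-reflexive (sum≡ q j)))))
  (subst (λ N → 2 * m + 2 * r ≤ suc N) (sym N≡) (ℕ.≤-reflexive (sum≡ q j)))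
  N≡
  λ { 0F → ℕ.≤-reflexive (twice q) , inj₁ (1F , 2F , (λ ()) , (λ ()) , (λ ()) ,
      ℕ.≤-trans (ℕ.≤-reflexive (twice-r j)) (ℕ.≤-trans (ℕ.*-monoʳ-≤ 2 (ℕ.<⇒≤ r<m)) (ℕ.n≤1+n _)))
    ; 1F → small , inj₂ (2F , (λ ()) , ℕ.≤-refl)
    ; 2F → small , inj₂ (1F , (λ ()) , ℕ.≤-refl) }
  where
  shape : ∀ (q j : ℕ) → suc (2 * suc q) + 2 * (3 + j) ≡ 2 + suc ((2 + 2 * q) + (2 + j) + (2 + j))
  shape = solve-∀
  sum≡ : ∀ (q j : ℕ) → 2 * suc q + 2 * (3 + j) ≡ suc (suc ((2 + 2 * q) + (2 + j) + (2 + j)))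
  sum≡ = solve-∀
  2m+m≡3m : ∀ (m : ℕ) → 2 * m + m ≡ 3 * m
  2m+m≡3m = solve-∀
  twice : ∀ (q : ℕ) → 3 + 2 * q ≡ 1 + 2 * suc q
  twice = solve-∀
  twice-r : ∀ (j : ℕ) → suc (suc ((2 + j) + (2 + j))) ≡ 2 * (3 + j)
  twice-r = solve-∀
  small : 2 + j < suc (2 * m)
  small = ℕ.≤-trans (ℕ.<⇒≤ r<m) (ℕ.≤-trans (ℕ.m≤m+n m (m + 0)) (ℕ.n≤1+n _))

  N≡ : suc (2 * m) + 2 * r ∸ 2 ≡ suc ((2 + 2 * q) + (2 + j) + (2 + j))
  N≡ = cong (_∸ 2) (shape q j)

theorem3p4 : (r t : ℕ) → 3 ≤ r → t % 2 ≡ 1 →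
    (3 ≤ r → r ≤ (t ∸ 1) / 4 → gr 4 ⟨ P 5 ∶ S t r ⟩≡ ((3 * t ∸ 5) / 2)) ×
    (⌈ (t ∸ 1) / 4 ⌉ ≤ r → r ≤ (t ∸ 3) / 2 → gr 4 ⟨ P 5 ∶ S t r ⟩≡ (t + 2 * r ∸ 2))
theorem3p4 r t 3≤r odd = subst Statement (sym t≡) (few , many)
  where
  Statement : ℕ → Set
  Statement t =
    (3 ≤ r → r ≤ (t ∸ 1) / 4 → gr 4 ⟨ P 5 ∶ S t r ⟩≡ ((3 * t ∸ 5) / 2)) ×
    (⌈ (t ∸ 1) / 4 ⌉ ≤ r → r ≤ (t ∸ 3) / 2 → gr 4 ⟨ P 5 ∶ S t r ⟩≡ (t + 2 * r ∸ 2))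

  m : ℕ
  m = t / 2

  t≡ : t ≡ suc (2 * m)
  t≡ = trans (m≡m%n+[m/n]*n t 2) (cong₂ _+_ odd (ℕ.*-comm m 2))

  4*≡ : ∀ (x : ℕ) → 2 * (2 * x) ≡ x * 4
  4*≡ = solve-∀

  few : 3 ≤ r → r ≤ 2 * m / 4 → _
  few _ r≤ = few-triangles r m 3≤r (ℕ.*-cancelˡ-≤ 2 (begin
    2 * (2 * r)     ≡⟨ 4*≡ r ⟩
    r * 4           ≤⟨ ℕ.*-monoˡ-≤ 4 r≤ ⟩
    2 * m / 4 * 4   ≤⟨ m/n*n≤m (2 * m) 4 ⟩
    2 * m           ∎))
    where open ℕ.≤-Reasoning

  many : ⌈ 2 * m / 4 ⌉ ≤ r → r ≤ (suc (2 * m) ∸ 3) / 2 → _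
  many ≤r r≤ = many-triangles r m 3≤r r<m m≤2r
    where
    open ℕ.≤-Reasoning
    2r≤ : r * 2 ≤ suc (2 * m) ∸ 3
    2r≤ = ℕ.≤-trans (ℕ.*-monoˡ-≤ 2 r≤) (m/n*n≤m (suc (2 * m) ∸ 3) 2)
    -- Since r ≥ 3, the difference t ∸ 3 is positive and so not truncated.
    3≤t : 3 ≤ suc (2 * m)
    3≤t = ℕ.<⇒≤ (ℕ.m∸n≢0⇒n<m λ eq → ℕ.n≮0 (subst (6 ≤_) eq (ℕ.≤-trans (ℕ.*-monoˡ-≤ 2 3≤r) 2r≤)))
    2[1+r]≡ : ∀ (r : ℕ) → suc (2 * suc r) ≡ r * 2 + 3
    2[1+r]≡ = solve-∀
    r<m : r < m
    r<m = ℕ.*-cancelˡ-≤ 2 (s≤s⁻¹ (ℕ.≤-trans (ℕ.≤-reflexive (2[1+r]≡ r)) (ℕ.m≤o∸n⇒m+n≤o _ 3≤t 2r≤)))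
    m≤2r : m ≤ 2 * r
    m≤2r = ℕ.*-cancelˡ-≤ 2 (ℕ.+-cancelʳ-≤ 3 _ _ (begin
      -- The ceiling is (2m + 3) / 4 rounded down, with remainder at most 3.
      2 * m + 3                                   ≡⟨ m≡m%n+[m/n]*n (2 * m + 3) 4 ⟩
      (2 * m + 3) % 4 + (2 * m + 3) / 4 * 4       ≤⟨ ℕ.+-mono-≤ (s≤s⁻¹ (m%n<n (2 * m + 3) 4)) (ℕ.*-monoˡ-≤ 4 ≤r) ⟩
      3 + r * 4                                   ≡⟨ trans (ℕ.+-comm 3 (r * 4)) (cong (_+ 3) (sym (4*≡ r))) ⟩
      2 * (2 * r) + 3                             ∎))
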